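{- If there exists an $r$-regular maximal $(2,3)$-antichain on $n$ points, then $r\geqslant\left(\frac{9}{10}+o(1)\right)n$ as $n\to\infty$. That is: for every $\varepsilon>0$ there is an $n_0$ such that for every integer $n\geqslant n_0$ and every integer $r$ for which an $r$-regular maximal $(2,3)$-antichain on $n$ points exists, one has $r\geqslant\left(\frac{9}{10}-\varepsilon\right)n$.
   Context: Let $[n]=\{1,2,\ldots,n\}$, $n\geqslant 3$. A maximal $(2,3)$-antichain on $n$ points is a family $\mathcal{A}=\mathcal{A}_2\cup\mathcal{A}_3$ with $\mathcal{A}_2\subseteq\binom{[n]}{2}$ (2-element subsets) and $\mathcal{A}_3\subseteq\binom{[n]}{3}$ (3-element subsets) such that (1) no member of $\mathcal{A}$ is a subset of another member of $\mathcal{A}$, and (2) for every $X\in 2^{[n]}\setminus\mathcal{A}$ there is an $A\in\mathcal{A}$ with $X\subseteq A$ or $A\subseteq X$. It is $r$-regular if every element of $[n]$ is contained in exactly $r$ members of $\mathcal{A}$. -}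

module Defs where

open import Data.Fin using (Fin)
open import Data.Fin.Subset using (Subset; ∣_∣; _⊆_)
open import Data.Fin.Subset.Properties using (_∈?_)
open import Data.List using (List; length; filter)
open import Data.List.Membership.Propositional using (_∈_; _∉_)
open import Data.List.Relation.Unary.Unique.Propositional using (Unique)
open import Data.Nat using (ℕ)
open import Data.Product using (_×_; ∃-syntax)
open import Data.Sum using (_⊎_)
open import Relation.Binary.PropositionalEquality using (_≡_; _≢_)
open import Relation.Nullary using (¬_)

-- A finite family of subsets of an n-point set, as a duplicate-free list;
-- uniqueness is what makes `degree` count members rather than occurrences.
record Family (n : ℕ) : Set where
  field
    members : List (Subset n)
    unique  : Unique members

open Family public

infix 4 _∈ᶠ_ _∉ᶠ_

_∈ᶠ_ : ∀ {n} → Subset n → Family n → Set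
X ∈ᶠ 𝒜 = X ∈ members 𝒜

_∉ᶠ_ : ∀ {n} → Subset n → Family n → Set
X ∉ᶠ 𝒜 = X ∉ members 𝒜

degree : ∀ {n} → Family n → Fin n → ℕ
degree 𝒜 i = length (filter (i ∈?_) (members 𝒜))

record IsMaximal23Antichain {n : ℕ} (𝒜 : Family n) : Set where
  field
    sizes     : ∀ {X} → X ∈ᶠ 𝒜 → ∣ X ∣ ≡ 2 ⊎ ∣ X ∣ ≡ 3
    antichain : ∀ {X Y} → X ∈ᶠ 𝒜 → Y ∈ᶠ 𝒜 → X ≢ Y → ¬ (X ⊆ Y)
    maximal   : ∀ X → X ∉ᶠ 𝒜 → ∃[ A ] (A ∈ᶠ 𝒜 × (X ⊆ A ⊎ A ⊆ X))

IsRegular : ∀ {n} → ℕ → Family n → Set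
IsRegular r 𝒜 = ∀ i → degree 𝒜 i ≡ r

module Submission where

-- Let x ~ y when no 2-set of the antichain contains both x and y, and let codeg x y be the number
-- of common neighbours of x and y.  By maximality every edge lies in a triangle and every triangle
-- lies in a 3-set of the antichain, so that regularity gives, with σ = 2 (n - 1 - r),
--   deg v ≥ σ + excess v,   excess v = Σ_{w ~ v} (codeg v w - 1).
-- If xwu is a triangle and codeg x w = 1, inclusion-exclusion for the neighbourhoods of x, w and u
-- yields 3σ + excess x + excess w ≤ n + 3.  Call an edge heavy if its codegree is at least a large
-- constant K, and draw an arc x → w if codeg x w = 1 and the third vertex u of the triangle on xw
-- makes wu heavy.  Up to an error O(n/K), the indegree is at most the excess and the outdegree is
-- at least σ minus the number of light edges: those whose ends are both joined by non-heavy edges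
-- to a common neighbour.  If there are o(n²) light edges, summing the inequality over all arcs and
-- using Cauchy-Schwarz for Σ indeg² gives 5σ ≤ n + o(n), that is, r ≥ (9/10 + o(1)) n.
--
-- That light edges are few is a Ruzsa-Szemerédi type statement: they join vertices of the sets
-- X u = {x : ux is a non-heavy edge}, and the graph has degrees at most K on each X u.  Partition
-- the vertices.  Whenever some X u meets both classes of a pair (σ , τ) in a constant proportion,
-- remove the nearly edgeless product (X u ∩ σ) × (X u ∩ τ) from the square of the vertex set and
-- refine the partition accordingly.  If such pairs cover a constant fraction of the square, so do
-- the removed products, so after boundedly many rounds hardly any such pair remains, and then
-- light edges are rare outside the removed region.
module Combinatorics where
  open import Defs
  import Data.Bool as Bool
  open import Data.Bool using (if_then_else_)
  open import Data.Empty using (⊥; ⊥-elim)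
  open import Data.Fin using (Fin; zero; suc; combine; remQuot; funToFin; finToFun)
  import Data.Fin as Fin
  import Data.Fin.Properties as Fin
  open import Data.Fin.Subset using (Subset; inside; outside; ∣_∣; _⊆_; ⁅_⁆; ⋃) renaming (_∈_ to _∈ₛ_)
  open import Data.Fin.Subset.Properties using (_∈?_; x∈⁅x⁆; x∈⁅y⁆⇒x≡y; x∈p∪q⁺; x∈p∪q⁻; ∉⊥; ⊆-refl)
  open import Data.List using (List; length; filter; lookup; map; _∷_; [])
  open import Data.List.Membership.Propositional using (_∈_; find; lose)
  open import Data.List.Membership.Propositional.Properties using (∈-filter⁺; ∈-filter⁻; ∈-lookup)
  import Data.List.Relation.Unary.Any as Any
  open import Data.List.Relation.Unary.Any using (Any; here; there; index)
  open import Data.List.Relation.Unary.Any.Properties using (lookup-index)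
  open import Data.Nat using (ℕ; zero; suc; z≤n; s≤s; s≤s⁻¹; NonZero; >-nonZero; _≤_; _<_; _+_; _*_; _∸_; _^_)
  open import Data.Nat.DivMod using (_/_; m/n*n≤m; m*n/n≡m; /-monoˡ-≤)
  open import Data.Nat.Properties
  open import Data.Nat.Tactic.RingSolver using (solve-∀)
  open import Data.Product using (_×_; _,_; proj₁; proj₂; ∃-syntax)
  open import Data.Sum using (_⊎_; inj₁; inj₂; [_,_]′)
  open import Data.Vec using (_∷_; [])
  import Data.Vec.Properties as Vec
  open import Algebra.Properties.Semiring.Sum +-*-semiring
    using (sum; sum-syntax; sum-cong-≗; ∑-distrib-+; ∑-comm; *-distribˡ-sum; *-distribʳ-sum)
  open import Function using (_∘_; case_of_)
  open import Relation.Binary using (Decidable; Symmetric)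
  open import Relation.Binary.PropositionalEquality
    using (_≡_; _≢_; refl; sym; trans; cong; cong₂; subst; module ≡-Reasoning)
  open import Relation.Nullary using (Dec; yes; no; does; ¬_; contradiction)
  open import Relation.Nullary.Decidable using (_×-dec_; _⊎-dec_; ¬?)

  -- Indicators and finite sums

  private variable
    n m : ℕ
    P Q : Set

  𝟙 : Dec P → ℕ
  𝟙 P? = if does P? then 1 else 0

  𝟙≤ : ∀ (P? : Dec P) {x} → (P → 1 ≤ x) → 𝟙 P? ≤ x
  𝟙≤ (yes p) h = h p
  𝟙≤ (no _)  h = z≤n

  1≤𝟙 : ∀ (P? : Dec P) → P → 1 ≤ 𝟙 P?
  1≤𝟙 (yes _) p = ≤-refl
  1≤𝟙 (no ¬p) p = contradiction p ¬p

  𝟙≤1 : ∀ (P? : Dec P) → 𝟙 P? ≤ 1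
  𝟙≤1 P? = 𝟙≤ P? (λ _ → ≤-refl)

  𝟙-⇔ : ∀ (P? : Dec P) (Q? : Dec Q) → (P → Q) → (Q → P) → 𝟙 P? ≡ 𝟙 Q?
  𝟙-⇔ P? Q? f g = ≤-antisym (𝟙≤ P? (1≤𝟙 Q? ∘ f)) (𝟙≤ Q? (1≤𝟙 P? ∘ g))

  𝟙-*-mono : ∀ (P? : Dec P) {x y} → (P → x ≤ y) → 𝟙 P? * x ≤ 𝟙 P? * y
  𝟙-*-mono (yes p) h = *-monoʳ-≤ 1 (h p)
  𝟙-*-mono (no _)  h = z≤n

  𝟙*≤ : ∀ (P? : Dec P) {x y} → (P → x ≤ y) → 𝟙 P? * x ≤ y
  𝟙*≤ (yes p) {x} h = ≤-trans (≤-reflexive (*-identityˡ x)) (h p)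
  𝟙*≤ (no _)  h = z≤n

  1≤* : ∀ {x y} → 1 ≤ x → 1 ≤ y → 1 ≤ x * y
  1≤* = *-mono-≤

  ∑-mono : ∀ {f g : Fin n → ℕ} → (∀ i → f i ≤ g i) → sum f ≤ sum g
  ∑-mono {zero}  h = z≤n
  ∑-mono {suc n} h = +-mono-≤ (h zero) (∑-mono (h ∘ suc))

  ∑-const : ∀ n c → ∑[ i < n ] c ≡ n * c
  ∑-const zero    c = refl
  ∑-const (suc n) c = cong (c +_) (∑-const n c)

  ∑≤n* : ∀ {f : Fin n → ℕ} c → (∀ i → f i ≤ c) → sum f ≤ n * c
  ∑≤n* {n} c h = ≤-trans (∑-mono h) (≤-reflexive (∑-const n c))

  term≤∑ : ∀ (f : Fin n → ℕ) i → f i ≤ sum f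
  term≤∑ f zero    = m≤m+n _ _
  term≤∑ f (suc i) = ≤-trans (term≤∑ (f ∘ suc) i) (m≤n+m _ _)

  two-terms≤∑ : ∀ (f : Fin n → ℕ) {i j} → i ≢ j → f i + f j ≤ sum f
  two-terms≤∑ f {zero}  {zero}  i≢j = contradiction refl i≢j
  two-terms≤∑ f {zero}  {suc j} i≢j = +-monoʳ-≤ _ (term≤∑ (f ∘ suc) j)
  two-terms≤∑ f {suc i} {zero}  i≢j =
    ≤-trans (≤-reflexive (+-comm (f (suc i)) _)) (+-monoʳ-≤ _ (term≤∑ (f ∘ suc) i))
  two-terms≤∑ f {suc i} {suc j} i≢j =
    ≤-trans (two-terms≤∑ (f ∘ suc) (i≢j ∘ cong suc)) (m≤n+m _ _)

  ∑-positive : ∀ (f : Fin n → ℕ) → 1 ≤ sum f → ∃[ i ] 1 ≤ f i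
  ∑-positive {suc n} f h with f zero in eq
  ... | suc _ = zero , subst (1 ≤_) (sym eq) (s≤s z≤n)
  ... | zero with ∑-positive (f ∘ suc) h
  ...   | i , p = suc i , p

  ∑∑-mono : ∀ {f g : Fin m → Fin n → ℕ} → (∀ i j → f i j ≤ g i j) →
    ∑[ i < m ] ∑[ j < n ] f i j ≤ ∑[ i < m ] ∑[ j < n ] g i j
  ∑∑-mono h = ∑-mono (λ i → ∑-mono (h i))

  ∑∑-cong : ∀ {f g : Fin m → Fin n → ℕ} → (∀ i j → f i j ≡ g i j) →
    ∑[ i < m ] ∑[ j < n ] f i j ≡ ∑[ i < m ] ∑[ j < n ] g i j
  ∑∑-cong h = sum-cong-≗ (λ i → sum-cong-≗ (h i))

  ∑∑-distrib-+ : ∀ (f g : Fin m → Fin n → ℕ) →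
    ∑[ i < m ] ∑[ j < n ] (f i j + g i j) ≡
    ∑[ i < m ] ∑[ j < n ] f i j + ∑[ i < m ] ∑[ j < n ] g i j
  ∑∑-distrib-+ f g =
    trans (sum-cong-≗ (λ i → ∑-distrib-+ (f i) (g i))) (∑-distrib-+ (sum ∘ f) (sum ∘ g))

  ∑∑-distribˡ-* : ∀ c (f : Fin m → Fin n → ℕ) →
    c * ∑[ i < m ] ∑[ j < n ] f i j ≡ ∑[ i < m ] ∑[ j < n ] (c * f i j)
  ∑∑-distribˡ-* c f = trans (*-distribˡ-sum c (sum ∘ f)) (sum-cong-≗ (λ i → *-distribˡ-sum c (f i)))

  ∑-*-∑ : ∀ (f : Fin m → ℕ) (g : Fin n → ℕ) →
    sum f * sum g ≡ ∑[ i < m ] ∑[ j < n ] (f i * g j)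
  ∑-*-∑ f g = trans (*-distribʳ-sum (sum g) f) (sum-cong-≗ (λ i → *-distribˡ-sum (f i) g))

  ∑-indicator : ∀ (c : Fin n) → ∑[ i < n ] 𝟙 (c Fin.≟ i) ≡ 1
  ∑-indicator {suc n} zero    = cong suc (trans (∑-const n 0) (*-zeroʳ n))
  ∑-indicator {suc n} (suc c) = trans (sum-cong-≗ eq) (∑-indicator c)
    where
    eq : ∀ i → 𝟙 (suc c Fin.≟ suc i) ≡ 𝟙 (c Fin.≟ i)
    eq i = 𝟙-⇔ (suc c Fin.≟ suc i) (c Fin.≟ i) Fin.suc-injective (cong suc)

  ∑-indicator-* : ∀ (c : Fin n) (F : Fin n → ℕ) → ∑[ i < n ] (𝟙 (c Fin.≟ i) * F i) ≡ F c
  ∑-indicator-* c F = begin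
    sum (λ i → 𝟙 (c Fin.≟ i) * F i) ≡⟨ sum-cong-≗ replace ⟩
    sum (λ i → 𝟙 (c Fin.≟ i) * F c) ≡⟨ *-distribʳ-sum (F c) (λ i → 𝟙 (c Fin.≟ i)) ⟨
    sum (λ i → 𝟙 (c Fin.≟ i)) * F c ≡⟨ cong (_* F c) (∑-indicator c) ⟩
    1 * F c                         ≡⟨ *-identityˡ (F c) ⟩
    F c                              ∎
    where
    open ≡-Reasoning
    replace : ∀ i → 𝟙 (c Fin.≟ i) * F i ≡ 𝟙 (c Fin.≟ i) * F c
    replace i with c Fin.≟ i
    ... | yes refl = refl
    ... | no _     = refl

  ∑-fibres : ∀ (π : Fin n → Fin m) (F : Fin m → ℕ) (G : Fin n → ℕ) →
    ∑[ x < n ] (F (π x) * G x) ≡ ∑[ σ < m ] (F σ * ∑[ x < n ] (𝟙 (π x Fin.≟ σ) * G x))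
  ∑-fibres {n} {m} π F G = begin
    ∑[ x < n ] (F (π x) * G x)
      ≡⟨ sum-cong-≗ (λ x → cong (_* G x) (∑-indicator-* (π x) F)) ⟨
    ∑[ x < n ] (∑[ σ < m ] (𝟙 (π x Fin.≟ σ) * F σ) * G x)
      ≡⟨ sum-cong-≗ (λ x → *-distribʳ-sum (G x) (λ σ → 𝟙 (π x Fin.≟ σ) * F σ)) ⟩
    ∑[ x < n ] ∑[ σ < m ] (𝟙 (π x Fin.≟ σ) * F σ * G x)
      ≡⟨ ∑-comm {n} {m} (λ x σ → 𝟙 (π x Fin.≟ σ) * F σ * G x) ⟩
    ∑[ σ < m ] ∑[ x < n ] (𝟙 (π x Fin.≟ σ) * F σ * G x)
      ≡⟨ sum-cong-≗ (λ σ → trans (sum-cong-≗ (λ x → rearrange (𝟙 (π x Fin.≟ σ)) (F σ) (G x)))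
                                 (sym (*-distribˡ-sum (F σ) (λ x → 𝟙 (π x Fin.≟ σ) * G x)))) ⟩
    ∑[ σ < m ] (F σ * ∑[ x < n ] (𝟙 (π x Fin.≟ σ) * G x)) ∎
    where
    open ≡-Reasoning
    rearrange : ∀ a b c → a * b * c ≡ b * (a * c)
    rearrange = solve-∀

  2xy≤x²+y² : ∀ x y → 2 * (x * y) ≤ x * x + y * y
  2xy≤x²+y² x y with ≤-total x y
  ... | inj₁ x≤y with m≤n⇒∃[o]m+o≡n x≤y
  ...   | z , refl = ≤-trans (m≤m+n _ (z * z)) (≤-reflexive (expand x z))
    where
    expand : ∀ x z → 2 * (x * (x + z)) + z * z ≡ x * x + (x + z) * (x + z)
    expand = solve-∀
  2xy≤x²+y² x y | inj₂ y≤x with m≤n⇒∃[o]m+o≡n y≤x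
  ...   | z , refl = ≤-trans (m≤m+n _ (z * z)) (≤-reflexive (expand y z))
    where
    expand : ∀ y z → 2 * ((y + z) * y) + z * z ≡ (y + z) * (y + z) + y * y
    expand = solve-∀

  -- Cauchy-Schwarz against the constant 1: add up 2 (f i) (f j) ≤ (f i)² + (f j)² over all ordered
  -- pairs (i , j).
  [∑f]²≤n∑f² : ∀ (f : Fin n → ℕ) → sum f * sum f ≤ n * ∑[ i < n ] (f i * f i)
  [∑f]²≤n∑f² {n} f = *-cancelˡ-≤ 2 (begin
    2 * (sum f * sum f)                       ≡⟨ cong (2 *_) (∑-*-∑ f f) ⟩
    2 * ∑[ i < n ] ∑[ j < n ] (f i * f j)     ≡⟨ ∑∑-distribˡ-* {n} {n} 2 (λ i j → f i * f j) ⟩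
    ∑[ i < n ] ∑[ j < n ] (2 * (f i * f j))   ≤⟨ ∑∑-mono {n} {n} (λ i j → 2xy≤x²+y² (f i) (f j)) ⟩
    ∑[ i < n ] ∑[ j < n ] (f i * f i + f j * f j)
      ≡⟨ ∑∑-distrib-+ {n} {n} (λ i j → f i * f i) (λ i j → f j * f j) ⟩
    ∑[ i < n ] ∑[ j < n ] (f i * f i) + ∑[ i < n ] ∑[ j < n ] (f j * f j)
      ≡⟨ cong₂ _+_ (trans (sum-cong-≗ (λ i → ∑-const n (f i * f i)))
                           (sym (*-distribˡ-sum n (λ i → f i * f i))))
                    (∑-const n (∑[ j < n ] (f j * f j))) ⟩
    n * S + n * S                            ≡⟨ double (n * S) ⟩
    2 * (n * S) ∎)
    where
    open ≤-Reasoning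
    S = ∑[ i < n ] (f i * f i)
    double : ∀ a → a + a ≡ 2 * a
    double = solve-∀

  ∑∑-comm : ∀ {k l} (T : Fin m → Fin n → Fin k → Fin l → ℕ) →
    ∑[ x < m ] ∑[ w < n ] ∑[ σ < k ] ∑[ τ < l ] T x w σ τ ≡
    ∑[ σ < k ] ∑[ τ < l ] ∑[ x < m ] ∑[ w < n ] T x w σ τ
  ∑∑-comm {m} {n} {k} {l} T = begin
    ∑[ x < m ] ∑[ w < n ] ∑[ σ < k ] ∑[ τ < l ] T x w σ τ
      ≡⟨ sum-cong-≗ (λ x → ∑-comm {n} {k} (λ w σ → ∑[ τ < l ] T x w σ τ)) ⟩
    ∑[ x < m ] ∑[ σ < k ] ∑[ w < n ] ∑[ τ < l ] T x w σ τ
      ≡⟨ ∑∑-cong {m} {k} (λ x σ → ∑-comm {n} {l} (λ w τ → T x w σ τ)) ⟩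
    ∑[ x < m ] ∑[ σ < k ] ∑[ τ < l ] ∑[ w < n ] T x w σ τ
      ≡⟨ ∑-comm {m} {k} (λ x σ → ∑[ τ < l ] ∑[ w < n ] T x w σ τ) ⟩
    ∑[ σ < k ] ∑[ x < m ] ∑[ τ < l ] ∑[ w < n ] T x w σ τ
      ≡⟨ sum-cong-≗ (λ σ → ∑-comm {m} {l} (λ x τ → ∑[ w < n ] T x w σ τ)) ⟩
    ∑[ σ < k ] ∑[ τ < l ] ∑[ x < m ] ∑[ w < n ] T x w σ τ ∎
    where open ≡-Reasoning

  -- Grouping the points by their classes turns a sum over the square into a sum over pairs of
  -- classes, where the summand factors into two masses. This is how areas of rectangles inside a
  -- pair of classes are compared.
  ∑∑-fibres : ∀ (π : Fin n → Fin m) (F : Fin m → Fin m → ℕ) (g h : Fin m → Fin m → Fin n → ℕ) →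
    ∑[ x < n ] ∑[ w < n ] (F (π x) (π w) * (g (π x) (π w) x * h (π x) (π w) w)) ≡
    ∑[ σ < m ] ∑[ τ < m ] (F σ τ * (∑[ x < n ] (𝟙 (π x Fin.≟ σ) * g σ τ x) *
                                     ∑[ w < n ] (𝟙 (π w Fin.≟ τ) * h σ τ w)))
  ∑∑-fibres {n} {m} π F g h = begin
    ∑[ x < n ] ∑[ w < n ] Φ (π x) (π w) x w
      ≡⟨ ∑∑-cong {n} {n} (λ x w → trans (∑-indicator-* (π x) (λ σ → ∑[ τ < m ] (𝟙 (π w Fin.≟ τ) * Φ σ τ x w)))
                                (∑-indicator-* (π w) (λ τ → Φ (π x) τ x w))) ⟨
    ∑[ x < n ] ∑[ w < n ] ∑[ σ < m ] (𝟙 (π x Fin.≟ σ) * ∑[ τ < m ] (𝟙 (π w Fin.≟ τ) * Φ σ τ x w))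
      ≡⟨ ∑∑-cong {n} {n} (λ x w → sum-cong-≗ (λ σ →
           *-distribˡ-sum (𝟙 (π x Fin.≟ σ)) (λ τ → 𝟙 (π w Fin.≟ τ) * Φ σ τ x w))) ⟩
    ∑[ x < n ] ∑[ w < n ] ∑[ σ < m ] ∑[ τ < m ] (𝟙 (π x Fin.≟ σ) * (𝟙 (π w Fin.≟ τ) * Φ σ τ x w))
      ≡⟨ ∑∑-comm {n} {n} {m} {m} (λ x w σ τ → 𝟙 (π x Fin.≟ σ) * (𝟙 (π w Fin.≟ τ) * Φ σ τ x w)) ⟩
    ∑[ σ < m ] ∑[ τ < m ] ∑[ x < n ] ∑[ w < n ] (𝟙 (π x Fin.≟ σ) * (𝟙 (π w Fin.≟ τ) * Φ σ τ x w))
      ≡⟨ ∑∑-cong {m} {m} factor ⟩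
    ∑[ σ < m ] ∑[ τ < m ] (F σ τ * (sum (a σ τ) * sum (b σ τ))) ∎
    where
    open ≡-Reasoning
    Φ : Fin m → Fin m → Fin n → Fin n → ℕ
    Φ σ τ x w = F σ τ * (g σ τ x * h σ τ w)
    a b : Fin m → Fin m → Fin n → ℕ
    a σ τ x = 𝟙 (π x Fin.≟ σ) * g σ τ x
    b σ τ w = 𝟙 (π w Fin.≟ τ) * h σ τ w
    rearrange : ∀ p q f g h → p * (q * (f * (g * h))) ≡ f * ((p * g) * (q * h))
    rearrange = solve-∀
    factor : ∀ σ τ → ∑[ x < n ] ∑[ w < n ] (𝟙 (π x Fin.≟ σ) * (𝟙 (π w Fin.≟ τ) * Φ σ τ x w)) ≡
                     F σ τ * (sum (a σ τ) * sum (b σ τ))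
    factor σ τ = begin
      ∑[ x < n ] ∑[ w < n ] (𝟙 (π x Fin.≟ σ) * (𝟙 (π w Fin.≟ τ) * Φ σ τ x w))
        ≡⟨ ∑∑-cong {n} {n} (λ x w → rearrange (𝟙 (π x Fin.≟ σ)) (𝟙 (π w Fin.≟ τ)) (F σ τ) (g σ τ x) (h σ τ w)) ⟩
      ∑[ x < n ] ∑[ w < n ] (F σ τ * (a σ τ x * b σ τ w))
        ≡⟨ ∑∑-distribˡ-* {n} {n} (F σ τ) (λ x w → a σ τ x * b σ τ w) ⟨
      F σ τ * ∑[ x < n ] ∑[ w < n ] (a σ τ x * b σ τ w)
        ≡⟨ cong (F σ τ *_) (∑-*-∑ (a σ τ) (b σ τ)) ⟨
      F σ τ * (sum (a σ τ) * sum (b σ τ)) ∎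

  -- Edges inside sets of small induced degree

  -- With j rounds left, k classes and at most Q n edges in the region removed so far.  A round picks
  -- at most one set for each pair of classes, hence one bit per vertex and pair of classes.
  edgeBudget : ℕ → ℕ → ℕ → ℕ → ℕ
  edgeBudget K zero    k Q = Q
  edgeBudget K (suc j) k Q = Q + edgeBudget K j (k * (2 ^ k) ^ k) (Q + k * (k * K))

  Q≤edgeBudget : ∀ K j k Q → Q ≤ edgeBudget K j k Q
  Q≤edgeBudget K zero    k Q = ≤-refl
  Q≤edgeBudget K (suc j) k Q = m≤m+n Q _

  module Holes {n : ℕ} (_~_ : Fin n → Fin n → Set) (_~?_ : Decidable _~_) (~-sym : Symmetric _~_)
    (X : Fin n → Fin n → Set) (X? : ∀ u x → Dec (X u x))
    (K : ℕ) (sparse : ∀ u x → X u x → ∑[ w < n ] (𝟙 (x ~? w) * 𝟙 (X? u w)) ≤ K)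
    where

    joint? : ∀ x w → Dec (∃[ u ] (X u x × X u w))
    joint? x w = Fin.any? (λ u → X? u x ×-dec X? u w)

    jointEdges : ℕ
    jointEdges = ∑[ x < n ] ∑[ w < n ] (𝟙 (x ~? w) * 𝟙 (joint? x w))

    -- `C` marks the pairs of classes whose product has been removed from the square of the vertex
    -- set. Areas and edges are counted as ordered pairs.
    uncovered : ∀ {k} (π : Fin n → Fin k) {C : Fin k → Fin k → Set} → Decidable C → ℕ
    uncovered π C? = ∑[ x < n ] ∑[ w < n ] 𝟙 (¬? (C? (π x) (π w)))

    coveredEdges : ∀ {k} (π : Fin n → Fin k) {C : Fin k → Fin k → Set} → Decidable C → ℕ
    coveredEdges π C? = ∑[ x < n ] ∑[ w < n ] (𝟙 (C? (π x) (π w)) * 𝟙 (x ~? w))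

    module _ {k : ℕ} (π : Fin n → Fin k) {C : Fin k → Fin k → Set} (C? : Decidable C) where

      mass : (Fin n → ℕ) → Fin k → ℕ
      mass G σ = ∑[ x < n ] (𝟙 (π x Fin.≟ σ) * G x)

      class : Fin k → ℕ
      class = mass (λ _ → 1)

      hit : Fin n → Fin k → ℕ
      hit u = mass (λ x → 𝟙 (X? u x))

      module _ (E : ℕ) where

        -- The set `X u` fills at least a proportion 1/E of the class; the product form avoids
        -- division. An empty class is big for every `u`, which is harmless as it has no area.
        Big : Fin n → Fin k → Set
        Big u σ = class σ ≤ E * hit u σ

        Big? : ∀ u σ → Dec (Big u σ)
        Big? u σ = class σ ≤? E * hit u σ

        Bad : Fin k → Fin k → Set
        Bad σ τ = ∃[ u ] (Big u σ × Big u τ)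

        Bad? : Decidable Bad
        Bad? σ τ = Fin.any? (λ u → Big? u σ ×-dec Big? u τ)

        badArea : ℕ
        badArea = ∑[ x < n ] ∑[ w < n ] (𝟙 (¬? (C? (π x) (π w))) * 𝟙 (Bad? (π x) (π w)))

        -- In a class where `X u` is not big it has fewer than a proportion 1/E of the points, and
        -- the classes partition the n vertices.
        small-hits : ∀ u → E * ∑[ x < n ] (𝟙 (¬? (Big? u (π x))) * 𝟙 (X? u x)) ≤ n
        small-hits u = begin
          E * ∑[ x < n ] (𝟙 (¬? (Big? u (π x))) * 𝟙 (X? u x))
            ≡⟨ cong (E *_) (∑-fibres π (λ σ → 𝟙 (¬? (Big? u σ))) (λ x → 𝟙 (X? u x))) ⟩
          E * ∑[ σ < k ] (𝟙 (¬? (Big? u σ)) * hit u σ)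
            ≡⟨ *-distribˡ-sum E (λ σ → 𝟙 (¬? (Big? u σ)) * hit u σ) ⟩
          ∑[ σ < k ] (E * (𝟙 (¬? (Big? u σ)) * hit u σ))
            ≤⟨ ∑-mono pointwise ⟩
          ∑[ σ < k ] (1 * class σ)
            ≡⟨ ∑-fibres π (λ _ → 1) (λ _ → 1) ⟨
          ∑[ x < n ] 1
            ≡⟨ trans (∑-const n 1) (*-identityʳ n) ⟩
          n ∎
          where
          open ≤-Reasoning
          swap : ∀ a b c → a * (b * c) ≡ b * (a * c)
          swap = solve-∀
          pointwise : ∀ σ → E * (𝟙 (¬? (Big? u σ)) * hit u σ) ≤ 1 * class σ
          pointwise σ = begin
            E * (𝟙 (¬? (Big? u σ)) * hit u σ) ≡⟨ swap E (𝟙 (¬? (Big? u σ))) (hit u σ) ⟩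
            𝟙 (¬? (Big? u σ)) * (E * hit u σ) ≤⟨ 𝟙*≤ (¬? (Big? u σ)) (<⇒≤ ∘ ≰⇒>) ⟩
            class σ                           ≡⟨ *-identityˡ (class σ) ⟨
            1 * class σ ∎

        -- Joint edges inside X u whose first endpoint lies in a class that X u barely meets.
        stray : Fin n → Fin n → Fin n → ℕ
        stray x w u = 𝟙 (¬? (Big? u (π x))) * 𝟙 (X? u x) * (𝟙 (x ~? w) * 𝟙 (X? u w))

        strays : ℕ
        strays = ∑[ x < n ] ∑[ w < n ] ∑[ u < n ] stray x w u

        -- Exchange the sums so that `w` is innermost. For each of the n sets `X u`, at most n/E
        -- points `x` qualify by `small-hits`, and each has at most K neighbours in `X u`.
        strays-bound : E * strays ≤ K * (n * n)
        strays-bound = begin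
          E * strays
            ≡⟨ cong (E *_) (sum-cong-≗ (λ x → ∑-comm {n} {n} (stray x))) ⟩
          E * ∑[ x < n ] ∑[ u < n ] ∑[ w < n ] stray x w u
            ≡⟨ cong (E *_) (∑-comm {n} {n} (λ x u → ∑[ w < n ] stray x w u)) ⟩
          E * ∑[ u < n ] ∑[ x < n ] ∑[ w < n ] stray x w u
            ≤⟨ *-monoʳ-≤ E (∑∑-mono {n} {n} inner) ⟩
          E * ∑[ u < n ] ∑[ x < n ] (a u x * K)
            ≡⟨ cong (E *_) (sum-cong-≗ (λ u → *-distribʳ-sum K (a u))) ⟨
          E * ∑[ u < n ] (sum (a u) * K)
            ≡⟨ *-distribˡ-sum E (λ u → sum (a u) * K) ⟩
          ∑[ u < n ] (E * (sum (a u) * K))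
            ≤⟨ ∑≤n* (n * K) (λ u → ≤-trans (≤-reflexive (sym (*-assoc E (sum (a u)) K)))
                                           (*-monoˡ-≤ K (small-hits u))) ⟩
          n * (n * K) ≡⟨ swap n K ⟩
          K * (n * n) ∎
          where
          open ≤-Reasoning
          swap : ∀ n K → n * (n * K) ≡ K * (n * n)
          swap = solve-∀
          a : Fin n → Fin n → ℕ
          a u x = 𝟙 (¬? (Big? u (π x))) * 𝟙 (X? u x)
          inner : ∀ u x → ∑[ w < n ] stray x w u ≤ a u x * K
          inner u x = begin
            ∑[ w < n ] stray x w u ≡⟨ *-distribˡ-sum (a u x) (λ w → 𝟙 (x ~? w) * 𝟙 (X? u w)) ⟨
            a u x * d ≡⟨ *-assoc (𝟙 (¬? (Big? u (π x)))) (𝟙 (X? u x)) d ⟩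
            𝟙 (¬? (Big? u (π x))) * (𝟙 (X? u x) * d)
              ≤⟨ *-monoʳ-≤ (𝟙 (¬? (Big? u (π x)))) (𝟙-*-mono (X? u x) (sparse u x)) ⟩
            𝟙 (¬? (Big? u (π x))) * (𝟙 (X? u x) * K) ≡⟨ *-assoc (𝟙 (¬? (Big? u (π x)))) (𝟙 (X? u x)) K ⟨
            a u x * K ∎
            where d = ∑[ w < n ] (𝟙 (x ~? w) * 𝟙 (X? u w))

        -- Let `u` witness that the edge xw is joint. If its pair of classes is neither covered nor
        -- bad, then `X u` is not big in the class of `x` or in that of `w`. The edge is then a
        -- stray, possibly with its ends exchanged, whence the factor 2.
        jointEdges-bound : E * jointEdges ≤ E * coveredEdges π C? + E * badArea + 2 * K * (n * n)
        jointEdges-bound = begin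
          E * jointEdges
            ≤⟨ *-monoʳ-≤ E (∑∑-mono {n} {n} pointwise) ⟩
          E * ∑[ x < n ] ∑[ w < n ] (f x w + g x w + (s x w + s w x))
            ≡⟨ cong (E *_) (∑∑-distrib-+ {n} {n} (λ x w → f x w + g x w) (λ x w → s x w + s w x)) ⟩
          E * (∑[ x < n ] ∑[ w < n ] (f x w + g x w) + ∑[ x < n ] ∑[ w < n ] (s x w + s w x))
            ≡⟨ cong (E *_) (cong₂ _+_ (∑∑-distrib-+ {n} {n} f g)
                 (trans (∑∑-distrib-+ {n} {n} s (λ x w → s w x))
                        (cong (strays +_) (∑-comm {n} {n} (λ x w → s w x))))) ⟩
          E * (coveredEdges π C? + badArea + (strays + strays))
            ≡⟨ expand E (coveredEdges π C?) badArea strays ⟩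
          E * coveredEdges π C? + E * badArea + 2 * (E * strays)
            ≤⟨ +-monoʳ-≤ (E * coveredEdges π C? + E * badArea) (*-monoʳ-≤ 2 strays-bound) ⟩
          E * coveredEdges π C? + E * badArea + 2 * (K * (n * n))
            ≡⟨ cong (E * coveredEdges π C? + E * badArea +_) (*-assoc 2 K (n * n)) ⟨
          E * coveredEdges π C? + E * badArea + 2 * K * (n * n) ∎
          where
          open ≤-Reasoning
          expand : ∀ E a b c → E * (a + b + (c + c)) ≡ E * a + E * b + 2 * (E * c)
          expand = solve-∀
          f g s : Fin n → Fin n → ℕ
          f x w = 𝟙 (C? (π x) (π w)) * 𝟙 (x ~? w)
          g x w = 𝟙 (¬? (C? (π x) (π w))) * 𝟙 (Bad? (π x) (π w))
          s x w = ∑[ u < n ] stray x w u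
          1≤stray : ∀ {x w u} → ¬ Big u (π x) → X u x → x ~ w → X u w → 1 ≤ stray x w u
          1≤stray {x} {w} {u} ¬big p x~w q =
            1≤* (1≤* (1≤𝟙 (¬? (Big? u (π x))) ¬big) (1≤𝟙 (X? u x) p))
                (1≤* (1≤𝟙 (x ~? w) x~w) (1≤𝟙 (X? u w) q))
          cases : ∀ x w → x ~ w → ∃[ u ] (X u x × X u w) → 1 ≤ f x w + g x w + (s x w + s w x)
          cases x w x~w (u , p , q) with C? (π x) (π w) | Bad? (π x) (π w) | Big? u (π x) | Big? u (π w)
          ... | yes c | _     | _      | _      = ≤-trans (1≤* {1} ≤-refl (1≤𝟙 (x ~? w) x~w)) (≤-trans (m≤m+n _ _) (m≤m+n _ _))
          ... | no _  | yes _ | _      | _      = m≤m+n 1 (s x w + s w x)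
          ... | no _  | no _  | no ¬b  | _      =
            ≤-trans (1≤stray ¬b p x~w q) (≤-trans (term≤∑ (stray x w) u) (m≤m+n (s x w) (s w x)))
          ... | no _  | no _  | yes _  | no ¬b  =
            ≤-trans (1≤stray ¬b q (~-sym x~w) p) (≤-trans (term≤∑ (stray w x) u) (m≤n+m (s w x) (s x w)))
          ... | no _  | no ¬bad | yes b | yes b′ = contradiction (u , b , b′) ¬bad
          pointwise : ∀ x w → 𝟙 (x ~? w) * 𝟙 (joint? x w) ≤ f x w + g x w + (s x w + s w x)
          pointwise x w = 𝟙*≤ (x ~? w) (λ x~w → 𝟙≤ (joint? x w) (cases x w x~w))

        -- One round of refinement

        module Refinement where

          -- Reading one witness `u` off the decision keeps the number of sets used in a round at no
          -- more than k². A pair that is not bad gets the empty set.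
          Chosen : ∀ {σ τ} → Dec (Bad σ τ) → Fin n → Set
          Chosen (yes (u , _)) = X u
          Chosen (no _)        = λ _ → ⊥

          chosen? : ∀ {σ τ} (d : Dec (Bad σ τ)) x → Dec (Chosen d x)
          chosen? (yes (u , _)) = X? u
          chosen? (no _)        = λ _ → no (λ ())

          chosen-sparse : ∀ {σ τ} (d : Dec (Bad σ τ)) x → Chosen d x →
            ∑[ w < n ] (𝟙 (x ~? w) * 𝟙 (chosen? d w)) ≤ K
          chosen-sparse (yes (u , _)) = sparse u
          chosen-sparse (no _) x ()

          H : Fin k → Fin k → Fin n → Set
          H σ τ = Chosen (Bad? σ τ)

          H? : ∀ σ τ x → Dec (H σ τ x)
          H? σ τ = chosen? (Bad? σ τ)

          k′ : ℕ
          k′ = k * (2 ^ k) ^ k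

          bit : ∀ {P : Set} → Dec P → Fin 2
          bit P? = if does P? then suc zero else zero

          bit⇒ : ∀ {P : Set} (P? : Dec P) → bit P? ≡ suc zero → P
          bit⇒ (yes p) _ = p

          ⇒bit : ∀ {P : Set} (P? : Dec P) → P → bit P? ≡ suc zero
          ⇒bit (yes _) _ = refl
          ⇒bit (no ¬p) p = contradiction p ¬p

          -- The new class of `x` encodes its old class together with its membership in the set
          -- chosen for each pair of old classes. Whether (x , w) lies in a newly removed rectangle
          -- thus depends on the new classes alone.
          π′ : Fin n → Fin k′
          π′ x = combine (π x) (funToFin (λ σ → funToFin (λ τ → bit (H? σ τ x))))

          base : Fin k′ → Fin k
          base κ = proj₁ (remQuot {k} ((2 ^ k) ^ k) κ)

          bits : Fin k′ → Fin k → Fin k → Fin 2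
          bits κ σ = finToFun (finToFun (proj₂ (remQuot {k} ((2 ^ k) ^ k) κ)) σ)

          base-π′ : ∀ x → base (π′ x) ≡ π x
          base-π′ x = cong proj₁ (Fin.remQuot-combine (π x) _)

          bits-π′ : ∀ x σ τ → bits (π′ x) σ τ ≡ bit (H? σ τ x)
          bits-π′ x σ τ = begin
            bits (π′ x) σ τ
              ≡⟨ cong (λ p → finToFun (finToFun (proj₂ p) σ) τ)
                      (Fin.remQuot-combine (π x) (funToFin (λ σ → funToFin (λ τ → bit (H? σ τ x))))) ⟩
            finToFun (finToFun (funToFin (λ σ → funToFin (λ τ → bit (H? σ τ x)))) σ) τ
              ≡⟨ cong (λ c → finToFun c τ) (Fin.finToFun-funToFin (λ σ → funToFin (λ τ → bit (H? σ τ x))) σ) ⟩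
            finToFun (funToFin (λ τ → bit (H? σ τ x))) τ
              ≡⟨ Fin.finToFun-funToFin (λ τ → bit (H? σ τ x)) τ ⟩
            bit (H? σ τ x) ∎
            where open ≡-Reasoning

          C′ : Fin k′ → Fin k′ → Set
          C′ κ μ = C (base κ) (base μ) ⊎
            (bits κ (base κ) (base μ) ≡ suc zero × bits μ (base κ) (base μ) ≡ suc zero)

          C′? : Decidable C′
          C′? κ μ = C? (base κ) (base μ) ⊎-dec
            (bits κ (base κ) (base μ) Fin.≟ suc zero ×-dec bits μ (base κ) (base μ) Fin.≟ suc zero)

          C′⇒ : ∀ x w → C′ (π′ x) (π′ w) → C (π x) (π w) ⊎ (H (π x) (π w) x × H (π x) (π w) w)
          C′⇒ x w c rewrite base-π′ x | base-π′ w | bits-π′ x (π x) (π w) | bits-π′ w (π x) (π w) =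
            [ inj₁ , (λ (p , q) → inj₂ (bit⇒ (H? (π x) (π w) x) p , bit⇒ (H? (π x) (π w) w) q)) ]′ c

          ⇒C′ : ∀ x w → C (π x) (π w) ⊎ (H (π x) (π w) x × H (π x) (π w) w) → C′ (π′ x) (π′ w)
          ⇒C′ x w c rewrite base-π′ x | base-π′ w | bits-π′ x (π x) (π w) | bits-π′ w (π x) (π w) =
            [ inj₁ , (λ (p , q) → inj₂ (⇒bit (H? (π x) (π w) x) p , ⇒bit (H? (π x) (π w) w) q)) ]′ c

          hole : Fin n → Fin n → ℕ
          hole x w = 𝟙 (¬? (C? (π x) (π w))) * 𝟙 (Bad? (π x) (π w)) *
                     (𝟙 (H? (π x) (π w) x) * 𝟙 (H? (π x) (π w) w))

          -- For a bad pair with witness `u`, multiplying the two inequalities of `Big` shows that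
          -- the rectangle cut out by `X u` has at least 1/E² of the area of the pair. Sum over the
          -- uncovered bad pairs.
          badArea≤holes : badArea ≤ E * E * ∑[ x < n ] ∑[ w < n ] hole x w
          badArea≤holes = begin
            badArea
              ≡⟨ ∑∑-cong {n} {n} (λ x w → *-identityʳ (F (π x) (π w))) ⟨
            ∑[ x < n ] ∑[ w < n ] (F (π x) (π w) * (1 * 1))
              ≡⟨ ∑∑-fibres π F (λ _ _ _ → 1) (λ _ _ _ → 1) ⟩
            ∑[ σ < k ] ∑[ τ < k ] (F σ τ * (class σ * class τ))
              ≤⟨ ∑∑-mono {k} {k} pointwise ⟩
            ∑[ σ < k ] ∑[ τ < k ] (E * E * (F σ τ * (mass (h σ τ) σ * mass (h σ τ) τ)))
              ≡⟨ ∑∑-distribˡ-* {k} {k} (E * E) (λ σ τ → F σ τ * (mass (h σ τ) σ * mass (h σ τ) τ)) ⟨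
            E * E * ∑[ σ < k ] ∑[ τ < k ] (F σ τ * (mass (h σ τ) σ * mass (h σ τ) τ))
              ≡⟨ cong (E * E *_) (∑∑-fibres π F h h) ⟨
            E * E * ∑[ x < n ] ∑[ w < n ] hole x w ∎
            where
            open ≤-Reasoning
            F : Fin k → Fin k → ℕ
            F σ τ = 𝟙 (¬? (C? σ τ)) * 𝟙 (Bad? σ τ)
            h : Fin k → Fin k → Fin n → ℕ
            h σ τ x = 𝟙 (H? σ τ x)
            rearrange : ∀ c E a b → c * ((E * a) * (E * b)) ≡ E * E * (c * (a * b))
            rearrange = solve-∀
            -- With the decision as an argument, one match evaluates both the indicator of `Bad` and
            -- the chosen set.
            bad-classes : ∀ c {σ τ} (d : Dec (Bad σ τ)) →
              c * 𝟙 d * (class σ * class τ) ≤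
              E * E * (c * 𝟙 d * (mass (λ x → 𝟙 (chosen? d x)) σ * mass (λ x → 𝟙 (chosen? d x)) τ))
            bad-classes c {σ} {τ} (yes (u , b , b′)) =
              ≤-trans (*-monoʳ-≤ (c * 1) (*-mono-≤ b b′)) (≤-reflexive (rearrange (c * 1) E (hit u σ) (hit u τ)))
            bad-classes c (no _) rewrite *-zeroʳ c = z≤n
            pointwise : ∀ σ τ → F σ τ * (class σ * class τ) ≤
                                E * E * (F σ τ * (mass (h σ τ) σ * mass (h σ τ) τ))
            pointwise σ τ = bad-classes (𝟙 (¬? (C? σ τ))) (Bad? σ τ)

          -- The holes lie outside the old removed region and inside the new one, so they are lost
          -- from the uncovered area; by `badArea≤holes` they amount to at least 1/E² of the bad
          -- area.
          area-decrement : badArea + E * E * uncovered π′ C′? ≤ E * E * uncovered π C?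
          area-decrement = begin
            badArea + E * E * uncovered π′ C′?
              ≤⟨ +-monoˡ-≤ _ badArea≤holes ⟩
            E * E * ∑[ x < n ] ∑[ w < n ] hole x w + E * E * uncovered π′ C′?
              ≡⟨ *-distribˡ-+ (E * E) (∑[ x < n ] ∑[ w < n ] hole x w) _ ⟨
            E * E * (∑[ x < n ] ∑[ w < n ] hole x w + uncovered π′ C′?)
              ≡⟨ cong (E * E *_) (∑∑-distrib-+ {n} {n} hole (λ x w → 𝟙 (¬? (C′? (π′ x) (π′ w))))) ⟨
            E * E * ∑[ x < n ] ∑[ w < n ] (hole x w + 𝟙 (¬? (C′? (π′ x) (π′ w))))
              ≤⟨ *-monoʳ-≤ (E * E) (∑∑-mono {n} {n} pointwise) ⟩
            E * E * uncovered π C? ∎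
            where
            open ≤-Reasoning
            cases : ∀ {P Q R S T : Set} (P? : Dec P) (Q? : Dec Q) (R? : Dec R) (S? : Dec S) (T? : Dec T) →
              (P → T) → (R × S → T) →
              𝟙 (¬? P?) * 𝟙 Q? * (𝟙 R? * 𝟙 S?) + 𝟙 (¬? T?) ≤ 𝟙 (¬? P?)
            cases (yes p) Q? R? S? T? f g = 𝟙≤ (¬? T?) (contradiction (f p))
            cases (no _) Q? (no _) S? T? f g rewrite *-zeroʳ (1 * 𝟙 Q?) = 𝟙≤1 (¬? T?)
            cases (no _) Q? (yes _) (no _) T? f g rewrite *-zeroʳ (1 * 𝟙 Q?) = 𝟙≤1 (¬? T?)
            cases (no _) Q? (yes r) (yes s) (yes t) f g =
              ≤-trans (≤-reflexive (trans (+-identityʳ _) (trans (*-identityʳ _) (*-identityˡ _)))) (𝟙≤1 Q?)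
            cases (no _) Q? (yes r) (yes s) (no ¬t) f g = contradiction (g (r , s)) ¬t
            pointwise : ∀ x w → hole x w + 𝟙 (¬? (C′? (π′ x) (π′ w))) ≤ 𝟙 (¬? (C? (π x) (π w)))
            pointwise x w = cases (C? (π x) (π w)) (Bad? (π x) (π w)) (H? (π x) (π w) x) (H? (π x) (π w) w)
              (C′? (π′ x) (π′ w)) (⇒C′ x w ∘ inj₁) (⇒C′ x w ∘ inj₂)

          -- A newly covered edge has both ends in the set chosen for its pair of classes. There are
          -- at most k² such sets, each with at most n vertices, each vertex having at most K
          -- neighbours within the set.
          coveredEdges-increment : coveredEdges π′ C′? ≤ coveredEdges π C? + k * (k * (n * K))
          coveredEdges-increment = begin
            coveredEdges π′ C′?
              ≤⟨ ∑∑-mono {n} {n} pointwise ⟩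
            ∑[ x < n ] ∑[ w < n ] (f x w + ∑[ σ < k ] ∑[ τ < k ] t x w σ τ)
              ≡⟨ ∑∑-distrib-+ {n} {n} f (λ x w → ∑[ σ < k ] ∑[ τ < k ] t x w σ τ) ⟩
            coveredEdges π C? + ∑[ x < n ] ∑[ w < n ] ∑[ σ < k ] ∑[ τ < k ] t x w σ τ
              ≡⟨ cong (coveredEdges π C? +_) (∑∑-comm {n} {n} {k} {k} t) ⟩
            coveredEdges π C? + ∑[ σ < k ] ∑[ τ < k ] ∑[ x < n ] ∑[ w < n ] t x w σ τ
              ≤⟨ +-monoʳ-≤ (coveredEdges π C?)
                   (∑≤n* (k * (n * K)) (λ σ → ∑≤n* (n * K) (λ τ → ∑≤n* K (inner σ τ)))) ⟩
            coveredEdges π C? + k * (k * (n * K)) ∎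
            where
            open ≤-Reasoning
            f : Fin n → Fin n → ℕ
            f x w = 𝟙 (C? (π x) (π w)) * 𝟙 (x ~? w)
            t : Fin n → Fin n → Fin k → Fin k → ℕ
            t x w σ τ = 𝟙 (H? σ τ x) * (𝟙 (x ~? w) * 𝟙 (H? σ τ w))
            inner : ∀ σ τ x → ∑[ w < n ] t x w σ τ ≤ K
            inner σ τ x = ≤-trans
              (≤-reflexive (sym (*-distribˡ-sum (𝟙 (H? σ τ x)) (λ w → 𝟙 (x ~? w) * 𝟙 (H? σ τ w)))))
              (𝟙*≤ (H? σ τ x) (chosen-sparse (Bad? σ τ) x))
            cases : ∀ x w → x ~ w → C (π x) (π w) ⊎ (H (π x) (π w) x × H (π x) (π w) w) →
              1 ≤ f x w + ∑[ σ < k ] ∑[ τ < k ] t x w σ τ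
            cases x w x~w (inj₁ c) =
              ≤-trans (1≤* (1≤𝟙 (C? (π x) (π w)) c) (1≤𝟙 (x ~? w) x~w)) (m≤m+n (f x w) _)
            cases x w x~w (inj₂ (p , q)) = begin
              1 ≤⟨ 1≤* (1≤𝟙 (H? (π x) (π w) x) p) (1≤* (1≤𝟙 (x ~? w) x~w) (1≤𝟙 (H? (π x) (π w) w) q)) ⟩
              t x w (π x) (π w) ≤⟨ term≤∑ (t x w (π x)) (π w) ⟩
              ∑[ τ < k ] t x w (π x) τ ≤⟨ term≤∑ (λ σ → ∑[ τ < k ] t x w σ τ) (π x) ⟩
              ∑[ σ < k ] ∑[ τ < k ] t x w σ τ ≤⟨ m≤n+m _ (f x w) ⟩
              f x w + ∑[ σ < k ] ∑[ τ < k ] t x w σ τ ∎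
            pointwise : ∀ x w → 𝟙 (C′? (π′ x) (π′ w)) * 𝟙 (x ~? w) ≤ f x w + ∑[ σ < k ] ∑[ τ < k ] t x w σ τ
            pointwise x w = 𝟙*≤ (C′? (π′ x) (π′ w)) (λ c → 𝟙≤ (x ~? w) (λ x~w → cases x w x~w (C′⇒ x w c)))

    module _ (Γ : ℕ) where

      -- Positive, hence cancellable, and so large that the stray term 2K n² multiplied by `Γ` stays
      -- below E n².
      E : ℕ
      E = suc (2 * K * Γ)

      -- Induction on the number j of rounds left. If the bad area is at most n²/Γ,
      -- `jointEdges-bound` finishes the proof, bad pairs and strays costing n² each. Otherwise one
      -- round lowers Γ E² times the uncovered area by more than n², so one round fewer is left.
      refine : ∀ j {k Q} (π : Fin n → Fin k) {C : Fin k → Fin k → Set} (C? : Decidable C) →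
        coveredEdges π C? ≤ Q * n → Γ * (E * E * uncovered π C?) ≤ j * (n * n) →
        Γ * jointEdges ≤ Γ * (edgeBudget K j k Q * n) + 2 * (n * n)
      refine j {k} {Q} π C? cov unc with Γ * badArea π C? E ≤? n * n
      ... | yes small = *-cancelˡ-≤ E (begin
        E * (Γ * jointEdges)
          ≡⟨ swap E Γ jointEdges ⟩
        Γ * (E * jointEdges)
          ≤⟨ *-monoʳ-≤ Γ (jointEdges-bound π C? E) ⟩
        Γ * (E * coveredEdges π C? + E * badArea π C? E + 2 * K * (n * n))
          ≡⟨ expand Γ E (coveredEdges π C?) (badArea π C? E) (2 * K) (n * n) ⟩
        E * (Γ * coveredEdges π C?) + E * (Γ * badArea π C? E) + 2 * K * Γ * (n * n)
          ≤⟨ +-mono-≤ (+-mono-≤ (*-monoʳ-≤ E (*-monoʳ-≤ Γ (≤-trans cov (*-monoˡ-≤ n (Q≤edgeBudget K j k Q)))))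
                                (*-monoʳ-≤ E small))
                      (*-monoˡ-≤ (n * n) (n≤1+n (2 * K * Γ))) ⟩
        E * (Γ * (edgeBudget K j k Q * n)) + E * (n * n) + E * (n * n)
          ≡⟨ collect E (Γ * (edgeBudget K j k Q * n)) (n * n) ⟩
        E * (Γ * (edgeBudget K j k Q * n) + 2 * (n * n)) ∎)
        where
        open ≤-Reasoning
        swap : ∀ a b c → a * (b * c) ≡ b * (a * c)
        swap = solve-∀
        expand : ∀ Γ E a b c d → Γ * (E * a + E * b + c * d) ≡ E * (Γ * a) + E * (Γ * b) + c * Γ * d
        expand = solve-∀
        collect : ∀ E a b → E * a + E * b + E * b ≡ E * (a + 2 * b)
        collect = solve-∀
      ... | no large = step j unc
        where
        open Refinement π C? E
        open ≤-Reasoning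
        distrib : ∀ Γ a b c → Γ * (a + b * c) ≡ Γ * a + Γ * (b * c)
        distrib = solve-∀
        decrement : n * n + Γ * (E * E * uncovered π′ C′?) < Γ * (E * E * uncovered π C?)
        decrement = begin-strict
          n * n + Γ * (E * E * uncovered π′ C′?)
            <⟨ +-monoˡ-< (Γ * (E * E * uncovered π′ C′?)) (≰⇒> large) ⟩
          Γ * badArea π C? E + Γ * (E * E * uncovered π′ C′?)
            ≡⟨ distrib Γ (badArea π C? E) (E * E) (uncovered π′ C′?) ⟨
          Γ * (badArea π C? E + E * E * uncovered π′ C′?)
            ≤⟨ *-monoʳ-≤ Γ area-decrement ⟩
          Γ * (E * E * uncovered π C?) ∎
        step : ∀ j → Γ * (E * E * uncovered π C?) ≤ j * (n * n) →
          Γ * jointEdges ≤ Γ * (edgeBudget K j k Q * n) + 2 * (n * n)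
        -- With no round left, `decrement` would put n² plus a natural number below 0.
        step zero    unc = contradiction (<-≤-trans decrement unc) λ ()
        step (suc j) unc = ≤-trans
          (refine j π′ C′? cov′ (+-cancelˡ-≤ (n * n) _ _ (≤-trans (<⇒≤ decrement) unc)))
          (+-monoˡ-≤ (2 * (n * n)) (*-monoʳ-≤ Γ (*-monoˡ-≤ n (m≤n+m _ Q))))
          where
          factor : ∀ Q n k K → Q * n + k * (k * (n * K)) ≡ (Q + k * (k * K)) * n
          factor = solve-∀
          cov′ : coveredEdges π′ C′? ≤ (Q + k * (k * K)) * n
          cov′ = begin
            coveredEdges π′ C′?                    ≤⟨ coveredEdges-increment ⟩
            coveredEdges π C? + k * (k * (n * K))  ≤⟨ +-monoˡ-≤ _ cov ⟩
            Q * n + k * (k * (n * K))              ≡⟨ factor Q n k K ⟩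
            (Q + k * (k * K)) * n ∎

      -- Start with a single class and nothing removed. The uncovered area is n², so Γ E² rounds
      -- suffice, and the size condition on n absorbs the edges of the removed region into a third
      -- n².
      jointEdges-few : Γ * edgeBudget K (Γ * (E * E)) 1 0 ≤ n → Γ * jointEdges ≤ 3 * (n * n)
      jointEdges-few n-large = begin
        Γ * jointEdges
          ≤⟨ refine (Γ * (E * E)) {Q = 0} (λ _ → zero) {λ _ _ → ⊥} (λ _ _ → no (λ ())) none all ⟩
        Γ * (budget * n) + 2 * (n * n) ≡⟨ cong (_+ 2 * (n * n)) (*-assoc Γ budget n) ⟨
        Γ * budget * n + 2 * (n * n)   ≤⟨ +-monoˡ-≤ (2 * (n * n)) (*-monoˡ-≤ n n-large) ⟩
        n * n + 2 * (n * n)            ≡⟨⟩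
        3 * (n * n) ∎
        where
        open ≤-Reasoning
        budget = edgeBudget K (Γ * (E * E)) 1 0
        none : ∑[ x < n ] ∑[ w < n ] 0 ≤ 0
        none = ≤-trans (∑≤n* {n} (n * 0) (λ _ → ∑≤n* {n} 0 (λ _ → ≤-refl)))
                       (≤-reflexive (trans (cong (n *_) (*-zeroʳ n)) (*-zeroʳ n)))
        all : Γ * (E * E * ∑[ x < n ] ∑[ w < n ] 1) ≤ Γ * (E * E) * (n * n)
        all = begin
          Γ * (E * E * ∑[ x < n ] ∑[ w < n ] 1) ≡⟨ *-assoc Γ (E * E) _ ⟨
          Γ * (E * E) * ∑[ x < n ] ∑[ w < n ] 1
            ≤⟨ *-monoʳ-≤ (Γ * (E * E)) (∑≤n* {n} n (λ _ → ≤-reflexive (trans (∑-const n 1) (*-identityʳ n)))) ⟩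
          Γ * (E * E) * (n * n) ∎

  -- Degree bounds in graphs whose edges lie in triangles

  private
    -- `S` stands for the number of arcs, `L` for that of light edges and `η` for a bound on heavy
    -- degrees, while σ is assumed to be at least n/5 + 2n/q - 2. Multiplied by q, the upper bound
    -- on 5σnS then leaves 8n²S ≤ 2q n²L, so arcs are few. Inserted into the lower bound on arcs,
    -- this yields 10n² ≤ 6n².
    arithmetic-contradiction : ∀ q n σ η S L → 13 * q ≤ n → 1 ≤ n →
      n * q + 10 * n ≤ 5 * q * σ + 10 * q → 12 * q * η ≤ 2 * n →
      5 * σ * n * S ≤ n * S * (n + 3 + 6 * η) + 2 * (n * n * L) →
      n * σ ≤ S + n * (2 * η) + L →
      (10 * (q * q) + 5 * q) * L ≤ 3 * (n * n) → ⊥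
    arithmetic-contradiction q n σ η S L 13q≤n 1≤n σ-large η-small upper lower L-small = <-irrefl refl (begin-strict
      6 * (n * n) <⟨ *-monoˡ-< (n * n) {{>-nonZero (1≤* 1≤n 1≤n)}} (m≤m+n 7 3) ⟩
      10 * (n * n) ≤⟨ m≤n+m (10 * (n * n)) (n * n * q) ⟩
      n * n * q + 10 * (n * n) ≡⟨ expand₁ n q ⟩
      n * (n * q + 10 * n) ≤⟨ *-monoʳ-≤ n σ-large ⟩
      n * (5 * q * σ + 10 * q) ≡⟨ expand₂ n q σ ⟩
      5 * q * (n * σ) + n * (10 * q) ≤⟨ +-mono-≤ (*-monoʳ-≤ (5 * q) lower) (*-monoʳ-≤ n (≤-trans (*-monoˡ-≤ q (m≤m+n 10 3)) 13q≤n)) ⟩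
      5 * q * (S + n * (2 * η) + L) + n * n ≡⟨ expand₃ q S n η L ⟩
      5 * q * S + 5 * q * L + n * (10 * q * η) + n * n
        ≤⟨ +-monoˡ-≤ (n * n) (+-mono-≤ (+-monoˡ-≤ (5 * q * L) (*-monoʳ-≤ (5 * q) S-small))
             (*-monoʳ-≤ n (≤-trans (*-monoˡ-≤ η (*-monoˡ-≤ q (m≤m+n 10 2))) η-small))) ⟩
      5 * q * (2 * q * L) + 5 * q * L + n * (2 * n) + n * n ≡⟨ expand₄ q L n ⟩
      (10 * (q * q) + 5 * q) * L + 3 * (n * n) ≤⟨ +-monoˡ-≤ (3 * (n * n)) L-small ⟩
      3 * (n * n) + 3 * (n * n) ≡⟨ double (n * n) ⟩
      6 * (n * n) ∎)
      where
      open ≤-Reasoning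
      expand₁ : ∀ n q → n * n * q + 10 * (n * n) ≡ n * (n * q + 10 * n)
      expand₁ = solve-∀
      expand₂ : ∀ n q σ → n * (5 * q * σ + 10 * q) ≡ 5 * q * (n * σ) + n * (10 * q)
      expand₂ = solve-∀
      expand₃ : ∀ q S n η L → 5 * q * (S + n * (2 * η) + L) + n * n ≡
        5 * q * S + 5 * q * L + n * (10 * q * η) + n * n
      expand₃ = solve-∀
      expand₄ : ∀ q L n → 5 * q * (2 * q * L) + 5 * q * L + n * (2 * n) + n * n ≡
        (10 * (q * q) + 5 * q) * L + 3 * (n * n)
      expand₄ = solve-∀
      double : ∀ a → 3 * a + 3 * a ≡ 6 * a
      double = solve-∀
      split : ∀ n S q → n * S * (n * q + 2 * n) + 8 * (n * n * S) ≡ n * S * (n * q + 10 * n)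
      split = solve-∀
      collect₁ : ∀ n S q σ → n * S * (5 * q * σ + 10 * q) ≡ q * (5 * σ * n * S) + n * S * (10 * q)
      collect₁ = solve-∀
      collect₂ : ∀ n S q η L → q * (n * S * (n + 3 + 6 * η) + 2 * (n * n * L)) + n * S * (10 * q) ≡
        n * S * (n * q + (13 * q + 6 * q * η)) + n * n * (2 * q * L)
      collect₂ = solve-∀
      twice : ∀ q η → 12 * q * η ≡ 2 * (6 * q * η)
      twice = solve-∀
      6qη≤n : 6 * q * η ≤ n
      6qη≤n = *-cancelˡ-≤ 2 (≤-trans (≤-reflexive (sym (twice q η))) η-small)
      S-small : S ≤ 2 * q * L
      S-small = *-cancelˡ-≤ (n * n) {{>-nonZero (1≤* 1≤n 1≤n)}} (≤-trans (m≤m+n (n * n * S) _)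
        (+-cancelˡ-≤ (n * S * (n * q + 2 * n)) _ _ (begin
          n * S * (n * q + 2 * n) + 8 * (n * n * S) ≡⟨ split n S q ⟩
          n * S * (n * q + 10 * n) ≤⟨ *-monoʳ-≤ (n * S) σ-large ⟩
          n * S * (5 * q * σ + 10 * q) ≡⟨ collect₁ n S q σ ⟩
          q * (5 * σ * n * S) + n * S * (10 * q) ≤⟨ +-monoˡ-≤ (n * S * (10 * q)) (*-monoʳ-≤ q upper) ⟩
          q * (n * S * (n + 3 + 6 * η) + 2 * (n * n * L)) + n * S * (10 * q) ≡⟨ collect₂ n S q η L ⟩
          n * S * (n * q + (13 * q + 6 * q * η)) + n * n * (2 * q * L)
            ≤⟨ +-monoˡ-≤ (n * n * (2 * q * L)) (*-monoʳ-≤ (n * S) (+-monoʳ-≤ (n * q)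
                 (≤-trans (+-mono-≤ 13q≤n 6qη≤n) (≤-reflexive (cong (n +_) (sym (+-identityʳ n))))))) ⟩
          n * S * (n * q + 2 * n) + n * n * (2 * q * L) ∎)))

  -- The sum of all size conditions on n. Here q is 1/ε up to rounding, K = 12q makes heavy degrees
  -- at most n/(6q), and Γ is the coefficient of `L` that arises in `arithmetic-contradiction`.
  threshold : ℕ → ℕ
  threshold q = 1 + 13 * q + Γ * edgeBudget K (Γ * (suc (2 * K * Γ) * suc (2 * K * Γ))) 1 0
    where
    K = 12 * q
    Γ = 10 * (q * q) + 5 * q

  module Graph {n : ℕ} (_~_ : Fin n → Fin n → Set) (_~?_ : Decidable _~_)
    (~-sym : Symmetric _~_) (~⇒≢ : ∀ {x y} → x ~ y → x ≢ y) where

    deg : Fin n → ℕ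
    deg v = ∑[ w < n ] 𝟙 (v ~? w)

    codeg : Fin n → Fin n → ℕ
    codeg x y = ∑[ z < n ] (𝟙 (x ~? z) * 𝟙 (y ~? z))

    codeg-sym : ∀ x y → codeg x y ≡ codeg y x
    codeg-sym x y = sum-cong-≗ (λ z → *-comm (𝟙 (x ~? z)) (𝟙 (y ~? z)))

    excess : Fin n → ℕ
    excess v = ∑[ w < n ] (𝟙 (v ~? w) * (codeg v w ∸ 1))

    deg≤n : ∀ v → deg v ≤ n
    deg≤n v = ≤-trans (∑≤n* 1 (λ w → 𝟙≤1 (v ~? w))) (≤-reflexive (*-identityʳ n))

    -- Three indicators satisfy a + b + c ≤ 1 + ab + ac + bc at every point.
    deg-inclusion-exclusion : ∀ x w u →
      deg x + deg w + deg u ≤ n + (codeg x w + (codeg x u + codeg w u))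
    deg-inclusion-exclusion x w u = begin
      deg x + deg w + deg u
        ≡⟨ trans (∑-distrib-+ (λ z → a z + b z) c) (cong (_+ deg u) (∑-distrib-+ a b)) ⟨
      ∑[ z < n ] (a z + b z + c z)
        ≤⟨ ∑-mono (λ z → pointwise (x ~? z) (w ~? z) (u ~? z)) ⟩
      ∑[ z < n ] (1 + (a z * b z + (a z * c z + b z * c z)))
        ≡⟨ trans (∑-distrib-+ (λ _ → 1) (λ z → a z * b z + (a z * c z + b z * c z)))
                 (cong₂ _+_ (trans (∑-const n 1) (*-identityʳ n))
                   (trans (∑-distrib-+ (λ z → a z * b z) (λ z → a z * c z + b z * c z))
                          (cong (codeg x w +_) (∑-distrib-+ (λ z → a z * c z) (λ z → b z * c z))))) ⟩
      n + (codeg x w + (codeg x u + codeg w u)) ∎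
      where
      open ≤-Reasoning
      a b c : Fin n → ℕ
      a z = 𝟙 (x ~? z)
      b z = 𝟙 (w ~? z)
      c z = 𝟙 (u ~? z)
      pointwise : ∀ {P Q R : Set} (P? : Dec P) (Q? : Dec Q) (R? : Dec R) →
        𝟙 P? + 𝟙 Q? + 𝟙 R? ≤ 1 + (𝟙 P? * 𝟙 Q? + (𝟙 P? * 𝟙 R? + 𝟙 Q? * 𝟙 R?))
      pointwise (yes _) (yes _) (yes _) = n≤1+n 3
      pointwise (yes _) (yes _) (no _)  = ≤-refl
      pointwise (yes _) (no _)  (yes _) = ≤-refl
      pointwise (yes _) (no _)  (no _)  = ≤-refl
      pointwise (no _)  (yes _) (yes _) = ≤-refl
      pointwise (no _)  (yes _) (no _)  = ≤-refl
      pointwise (no _)  (no _)  (yes _) = ≤-refl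
      pointwise (no _)  (no _)  (no _)  = z≤n

    m≤1+[m∸1] : ∀ m → m ≤ 1 + (m ∸ 1)
    m≤1+[m∸1] zero    = z≤n
    m≤1+[m∸1] (suc m) = ≤-refl

    module _ (σ : ℕ) (codeg-positive : ∀ {x y} → x ~ y → 1 ≤ codeg x y)
      (σ-bound : ∀ v → σ + ∑[ w < n ] (𝟙 (v ~? w) * codeg v w) ≤ 2 * deg v) where

      -- Every neighbour has codegree at least 1, so the sum of the codegrees at `v` is
      -- `deg v + excess v`; cancel `deg v` in `σ-bound`.
      σ+excess≤deg : ∀ v → σ + excess v ≤ deg v
      σ+excess≤deg v = +-cancelˡ-≤ (deg v) _ _ (begin
        deg v + (σ + excess v)
          ≡⟨ rearrange (deg v) σ (excess v) ⟩
        σ + (deg v + excess v)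
          ≡⟨ cong (σ +_) (∑-distrib-+ (λ w → 𝟙 (v ~? w)) (λ w → 𝟙 (v ~? w) * (codeg v w ∸ 1))) ⟨
        σ + ∑[ w < n ] (𝟙 (v ~? w) + 𝟙 (v ~? w) * (codeg v w ∸ 1))
          ≤⟨ +-monoʳ-≤ σ (∑-mono pointwise) ⟩
        σ + ∑[ w < n ] (𝟙 (v ~? w) * codeg v w)
          ≤⟨ σ-bound v ⟩
        2 * deg v
          ≡⟨ cong (deg v +_) (+-identityʳ (deg v)) ⟩
        deg v + deg v ∎)
        where
        open ≤-Reasoning
        rearrange : ∀ a b c → a + (b + c) ≡ b + (a + c)
        rearrange = solve-∀
        pointwise : ∀ w → 𝟙 (v ~? w) + 𝟙 (v ~? w) * (codeg v w ∸ 1) ≤ 𝟙 (v ~? w) * codeg v w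
        pointwise w = ≤-trans (≤-reflexive (sym (*-suc (𝟙 (v ~? w)) (codeg v w ∸ 1))))
          (𝟙-*-mono (v ~? w) (λ v~w → ≤-reflexive (m+[n∸m]≡n (codeg-positive v~w))))

      -- Compare the lower bounds for the three degrees with inclusion-exclusion. The codegrees of
      -- ux and uw cancel against `excess u`, to which the distinct neighbours `x` and `w`
      -- contribute all but 1 of each; with `codeg x w` this leaves 3.
      triangle-bound : ∀ {x w u} → x ~ w → x ~ u → w ~ u → codeg x w ≡ 1 →
        3 * σ + (excess x + excess w) ≤ n + 3
      triangle-bound {x} {w} {u} x~w x~u w~u c≡1 = +-cancelʳ-≤ (p + q) _ _ (begin
        3 * σ + (excess x + excess w) + (p + q)
          ≡⟨ split σ (excess x) (excess w) (p + q) ⟩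
        (σ + excess x) + (σ + excess w) + (σ + (p + q))
          ≤⟨ +-mono-≤ (+-mono-≤ (σ+excess≤deg x) (σ+excess≤deg w))
               (≤-trans (+-monoʳ-≤ σ p+q≤excess) (σ+excess≤deg u)) ⟩
        deg x + deg w + deg u
          ≤⟨ deg-inclusion-exclusion x w u ⟩
        n + (codeg x w + (codeg x u + codeg w u))
          ≡⟨ cong (n +_) (cong₂ _+_ c≡1 (cong₂ _+_ (codeg-sym x u) (codeg-sym w u))) ⟩
        n + (1 + (codeg u x + codeg u w))
          ≤⟨ +-monoʳ-≤ n (+-monoʳ-≤ 1 (+-mono-≤ (m≤1+[m∸1] (codeg u x)) (m≤1+[m∸1] (codeg u w)))) ⟩
        n + (1 + (1 + p + (1 + q)))
          ≡⟨ collect n p q ⟩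
        n + 3 + (p + q) ∎)
        where
        open ≤-Reasoning
        p = codeg u x ∸ 1
        q = codeg u w ∸ 1
        split : ∀ σ a b c → 3 * σ + (a + b) + c ≡ (σ + a) + (σ + b) + (σ + c)
        split = solve-∀
        collect : ∀ n p q → n + (1 + (1 + p + (1 + q))) ≡ n + 3 + (p + q)
        collect = solve-∀
        below : ∀ {v} → v ~ u → codeg u v ∸ 1 ≤ 𝟙 (u ~? v) * (codeg u v ∸ 1)
        below {v} v~u = ≤-trans (≤-reflexive (sym (*-identityˡ _)))
          (*-monoˡ-≤ (codeg u v ∸ 1) (1≤𝟙 (u ~? v) (~-sym v~u)))
        p+q≤excess : p + q ≤ excess u
        p+q≤excess = ≤-trans (+-mono-≤ (below x~u) (below w~u))
          (two-terms≤∑ (λ v → 𝟙 (u ~? v) * (codeg u v ∸ 1)) (~⇒≢ x~w))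

      -- Heavy edges, arcs and light edges

      module _ (K : ℕ) where

        Heavy : Fin n → Fin n → Set
        Heavy x y = K ≤ codeg x y

        Heavy? : Decidable Heavy
        Heavy? x y = K ≤? codeg x y

        Heavy-sym : Symmetric Heavy
        Heavy-sym {x} {y} = subst (K ≤_) (codeg-sym x y)

        heavyDeg : Fin n → ℕ
        heavyDeg v = ∑[ w < n ] (𝟙 (v ~? w) * 𝟙 (Heavy? v w))

        -- Each heavy edge at `v` adds at least K to the sum of codegrees, which `σ-bound` caps at 2
        -- `deg v`.
        K*heavyDeg≤2n : ∀ v → K * heavyDeg v ≤ 2 * n
        K*heavyDeg≤2n v = begin
          K * heavyDeg v
            ≡⟨ *-distribˡ-sum K (λ w → 𝟙 (v ~? w) * 𝟙 (Heavy? v w)) ⟩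
          ∑[ w < n ] (K * (𝟙 (v ~? w) * 𝟙 (Heavy? v w)))
            ≤⟨ ∑-mono pointwise ⟩
          ∑[ w < n ] (𝟙 (v ~? w) * codeg v w)
            ≤⟨ m≤n+m _ σ ⟩
          σ + ∑[ w < n ] (𝟙 (v ~? w) * codeg v w)
            ≤⟨ σ-bound v ⟩
          2 * deg v
            ≤⟨ *-monoʳ-≤ 2 (deg≤n v) ⟩
          2 * n ∎
          where
          open ≤-Reasoning
          rearrange : ∀ a b c → a * (b * c) ≡ b * (c * a)
          rearrange = solve-∀
          pointwise : ∀ w → K * (𝟙 (v ~? w) * 𝟙 (Heavy? v w)) ≤ 𝟙 (v ~? w) * codeg v w
          pointwise w = ≤-trans (≤-reflexive (rearrange K (𝟙 (v ~? w)) (𝟙 (Heavy? v w))))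
            (*-monoʳ-≤ (𝟙 (v ~? w)) (𝟙*≤ (Heavy? v w) (λ h → h)))

        Arc : Fin n → Fin n → Set
        Arc x w = x ~ w × codeg x w ≡ 1 × ∃[ u ] (x ~ u × w ~ u × Heavy w u)

        Arc? : Decidable Arc
        Arc? x w = x ~? w ×-dec codeg x w ≟ 1 ×-dec Fin.any? (λ u → x ~? u ×-dec w ~? u ×-dec Heavy? w u)

        outdeg indeg : Fin n → ℕ
        outdeg x = ∑[ w < n ] 𝟙 (Arc? x w)
        indeg w = ∑[ x < n ] 𝟙 (Arc? x w)

        heavyTriangle : Fin n → Fin n → Fin n → ℕ
        heavyTriangle w x u = 𝟙 (w ~? u) * 𝟙 (Heavy? w u) * (𝟙 (w ~? x) * 𝟙 (u ~? x))

        heavyTriangles-sum : ∀ w → ∑[ x < n ] ∑[ u < n ] heavyTriangle w x u ≡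
                                   ∑[ u < n ] (𝟙 (w ~? u) * 𝟙 (Heavy? w u) * codeg w u)
        heavyTriangles-sum w = trans (∑-comm {n} {n} (heavyTriangle w))
          (sum-cong-≗ (λ u → sym (*-distribˡ-sum (𝟙 (w ~? u) * 𝟙 (Heavy? w u)) (λ x → 𝟙 (w ~? x) * 𝟙 (u ~? x)))))

        1≤heavyTriangle : ∀ {w x u} → w ~ u → Heavy w u → w ~ x → u ~ x → 1 ≤ heavyTriangle w x u
        1≤heavyTriangle {w} {x} {u} w~u h w~x u~x =
          1≤* (1≤* (1≤𝟙 (w ~? u) w~u) (1≤𝟙 (Heavy? w u) h)) (1≤* (1≤𝟙 (w ~? x) w~x) (1≤𝟙 (u ~? x) u~x))

        -- An arc from `x` to `w` yields a triangle wxu with wu heavy, and a heavy edge wu lies in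
        -- `codeg w u` triangles. All but one of these are paid by the excess, the last one by the
        -- heavy edge itself.
        indeg≤ : ∀ w → indeg w ≤ excess w + heavyDeg w
        indeg≤ w = begin
          indeg w ≤⟨ ∑-mono arcs ⟩
          ∑[ x < n ] ∑[ u < n ] heavyTriangle w x u ≡⟨ heavyTriangles-sum w ⟩
          ∑[ u < n ] (𝟙 (w ~? u) * 𝟙 (Heavy? w u) * codeg w u) ≤⟨ ∑-mono pointwise ⟩
          ∑[ u < n ] (𝟙 (w ~? u) * (codeg w u ∸ 1) + 𝟙 (w ~? u) * 𝟙 (Heavy? w u))
            ≡⟨ ∑-distrib-+ (λ u → 𝟙 (w ~? u) * (codeg w u ∸ 1)) (λ u → 𝟙 (w ~? u) * 𝟙 (Heavy? w u)) ⟩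
          excess w + heavyDeg w ∎
          where
          open ≤-Reasoning
          arcs : ∀ x → 𝟙 (Arc? x w) ≤ ∑[ u < n ] heavyTriangle w x u
          arcs x = 𝟙≤ (Arc? x w) λ (x~w , _ , u , x~u , w~u , h) →
            ≤-trans (1≤heavyTriangle w~u h (~-sym x~w) (~-sym x~u)) (term≤∑ (heavyTriangle w x) u)
          cases : ∀ {P Q : Set} (P? : Dec P) (Q? : Dec Q) c → 𝟙 P? * 𝟙 Q? * c ≤ 𝟙 P? * (c ∸ 1) + 𝟙 P? * 𝟙 Q?
          cases (no _)  Q?      c = z≤n
          cases (yes _) (no _)  c = z≤n
          cases (yes _) (yes _) c = begin
            c + 0           ≡⟨ +-identityʳ c ⟩
            c               ≤⟨ m≤1+[m∸1] c ⟩
            1 + (c ∸ 1)     ≡⟨ +-comm 1 (c ∸ 1) ⟩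
            c ∸ 1 + 1       ≡⟨ cong (_+ 1) (+-identityʳ (c ∸ 1)) ⟨
            c ∸ 1 + 0 + 1   ∎
          pointwise : ∀ u → 𝟙 (w ~? u) * 𝟙 (Heavy? w u) * codeg w u ≤
                            𝟙 (w ~? u) * (codeg w u ∸ 1) + 𝟙 (w ~? u) * 𝟙 (Heavy? w u)
          pointwise u = cases (w ~? u) (Heavy? w u) (codeg w u)

        X : Fin n → Fin n → Set
        X u x = u ~ x × ¬ Heavy u x

        X? : ∀ u x → Dec (X u x)
        X? u x = u ~? x ×-dec ¬? (Heavy? u x)

        -- The neighbours of `x` inside `X u` are common neighbours of `x` and `u`, and the edge ux
        -- is not heavy.
        X-sparse : ∀ u x → X u x → ∑[ w < n ] (𝟙 (x ~? w) * 𝟙 (X? u w)) ≤ K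
        X-sparse u x (u~x , ¬h) = begin
          ∑[ w < n ] (𝟙 (x ~? w) * 𝟙 (X? u w))
            ≤⟨ ∑-mono (λ w → *-monoʳ-≤ (𝟙 (x ~? w)) (𝟙≤ (X? u w) (λ (u~w , _) → 1≤𝟙 (u ~? w) u~w))) ⟩
          codeg x u ≡⟨ codeg-sym x u ⟩
          codeg u x ≤⟨ <⇒≤ (≰⇒> ¬h) ⟩
          K ∎
          where open ≤-Reasoning

        open Holes _~_ _~?_ ~-sym X X? K X-sparse using (joint?; jointEdges; jointEdges-few)

        lightDeg : Fin n → ℕ
        lightDeg x = ∑[ w < n ] (𝟙 (x ~? w) * 𝟙 (joint? x w))

        -- Every edge xw is charged once. It goes to `R` if it is heavy or has codegree above 1.
        -- Otherwise let `u` complete a triangle on xw: the edge is an arc if wu is heavy, goes to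
        -- `T` if xu is heavy, and is light if neither is. `T` and `R` together cost at most the
        -- excess plus two per heavy edge, and the excess cancels against that in `σ+excess≤deg`.
        σ≤outdeg : ∀ x → σ ≤ outdeg x + 2 * heavyDeg x + lightDeg x
        σ≤outdeg x = +-cancelʳ-≤ (excess x) _ _ (begin
          σ + excess x
            ≤⟨ σ+excess≤deg x ⟩
          deg x
            ≤⟨ ∑-mono pointwise ⟩
          ∑[ w < n ] (𝟙 (Arc? x w) + (T w + R w) + ℓ w)
            ≡⟨ trans (∑-distrib-+ (λ w → 𝟙 (Arc? x w) + (T w + R w)) ℓ)
                 (cong (_+ lightDeg x) (trans (∑-distrib-+ (λ w → 𝟙 (Arc? x w)) (λ w → T w + R w))
                   (cong (outdeg x +_) (trans (∑-distrib-+ T R)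
                     (cong (_+ sum R) (heavyTriangles-sum x)))))) ⟩
          outdeg x + (sum T′ + sum R) + lightDeg x
            ≤⟨ +-monoˡ-≤ (lightDeg x) (+-monoʳ-≤ (outdeg x) T′+R) ⟩
          outdeg x + (excess x + 2 * heavyDeg x) + lightDeg x
            ≡⟨ rearrange (outdeg x) (excess x) (2 * heavyDeg x) (lightDeg x) ⟩
          outdeg x + 2 * heavyDeg x + lightDeg x + excess x ∎)
          where
          open ≤-Reasoning
          rearrange : ∀ a b c d → a + (b + c) + d ≡ a + c + d + b
          rearrange = solve-∀
          T T′ R ℓ : Fin n → ℕ
          T w = ∑[ u < n ] heavyTriangle x w u
          T′ w = 𝟙 (x ~? w) * 𝟙 (Heavy? x w) * codeg x w
          R w = 𝟙 (x ~? w) * (𝟙 (¬? (Heavy? x w)) * (codeg x w ∸ 1)) + 𝟙 (x ~? w) * 𝟙 (Heavy? x w)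
          ℓ w = 𝟙 (x ~? w) * 𝟙 (joint? x w)
          merge : ∀ {P Q : Set} (P? : Dec P) (Q? : Dec Q) c →
            𝟙 P? * 𝟙 Q? * c + (𝟙 P? * (𝟙 (¬? Q?) * (c ∸ 1)) + 𝟙 P? * 𝟙 Q?) ≤
            𝟙 P? * (c ∸ 1) + 2 * (𝟙 P? * 𝟙 Q?)
          merge (no _)  Q?      c = z≤n
          merge (yes _) (no _)  c = ≤-reflexive (cong (_+ 0) (+-identityʳ (c ∸ 1 + 0)))
          merge (yes _) (yes _) c = begin
            c + 0 + 1           ≡⟨ cong (_+ 1) (+-identityʳ c) ⟩
            c + 1               ≤⟨ +-monoˡ-≤ 1 (m≤1+[m∸1] c) ⟩
            1 + (c ∸ 1) + 1     ≡⟨ shift (c ∸ 1) ⟩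
            c ∸ 1 + 0 + 2       ∎
            where
            shift : ∀ d → 1 + d + 1 ≡ d + 0 + 2
            shift = solve-∀
          T′+R : sum T′ + sum R ≤ excess x + 2 * heavyDeg x
          T′+R = begin
            sum T′ + sum R ≡⟨ ∑-distrib-+ T′ R ⟨
            ∑[ w < n ] (T′ w + R w) ≤⟨ ∑-mono (λ w → merge (x ~? w) (Heavy? x w) (codeg x w)) ⟩
            ∑[ w < n ] (𝟙 (x ~? w) * (codeg x w ∸ 1) + 2 * (𝟙 (x ~? w) * 𝟙 (Heavy? x w)))
              ≡⟨ ∑-distrib-+ (λ w → 𝟙 (x ~? w) * (codeg x w ∸ 1)) (λ w → 2 * (𝟙 (x ~? w) * 𝟙 (Heavy? x w))) ⟩
            excess x + ∑[ w < n ] (2 * (𝟙 (x ~? w) * 𝟙 (Heavy? x w)))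
              ≡⟨ cong (excess x +_) (*-distribˡ-sum 2 (λ w → 𝟙 (x ~? w) * 𝟙 (Heavy? x w))) ⟨
            excess x + 2 * heavyDeg x ∎
          second : ∀ {w} → x ~ w → ¬ Heavy x w → codeg x w ≢ 1 → 1 ≤ R w
          second {w} x~w ¬h c≢1 = ≤-trans
            (1≤* (1≤𝟙 (x ~? w) x~w) (1≤* (1≤𝟙 (¬? (Heavy? x w)) ¬h)
              (m<n⇒0<n∸m (≤∧≢⇒< (codeg-positive x~w) (c≢1 ∘ sym)))))
            (m≤m+n _ _)
          third : ∀ {w} → x ~ w → Heavy x w → 1 ≤ R w
          third {w} x~w h = ≤-trans (1≤* (1≤𝟙 (x ~? w) x~w) (1≤𝟙 (Heavy? x w) h)) (m≤n+m _ _)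
          common : ∀ {w} → x ~ w → ∃[ u ] (x ~ u × w ~ u)
          common {w} x~w with ∑-positive (λ z → 𝟙 (x ~? z) * 𝟙 (w ~? z)) (codeg-positive x~w)
          ... | u , p with x ~? u | w ~? u
          ...   | yes x~u | yes w~u = u , x~u , w~u
          ...   | yes _   | no _    = contradiction p λ ()
          ...   | no _    | _       = contradiction p λ ()
          inArc : ∀ {w} {b c : ℕ} → 1 ≤ 𝟙 (Arc? x w) → 1 ≤ 𝟙 (Arc? x w) + b + c
          inArc p = ≤-trans p (≤-trans (m≤m+n _ _) (m≤m+n _ _))
          inT+R : ∀ {w} → 1 ≤ T w + R w → 1 ≤ 𝟙 (Arc? x w) + (T w + R w) + ℓ w
          inT+R {w} p = ≤-trans p (≤-trans (m≤n+m (T w + R w) (𝟙 (Arc? x w)))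
                                            (m≤m+n (𝟙 (Arc? x w) + (T w + R w)) (ℓ w)))
          inT : ∀ {w} → 1 ≤ T w → 1 ≤ 𝟙 (Arc? x w) + (T w + R w) + ℓ w
          inT {w} p = inT+R {w} (≤-trans p (m≤m+n (T w) (R w)))
          inR : ∀ {w} → 1 ≤ R w → 1 ≤ 𝟙 (Arc? x w) + (T w + R w) + ℓ w
          inR {w} p = inT+R {w} (≤-trans p (m≤n+m (R w) (T w)))
          cases : ∀ w → x ~ w → 1 ≤ 𝟙 (Arc? x w) + (T w + R w) + ℓ w
          cases w x~w = case Heavy? x w of λ where
            (yes h) → inR {w} (third x~w h)
            (no ¬h) → case codeg x w ≟ 1 of λ where
              (no c≢1)  → inR {w} (second x~w ¬h c≢1)
              (yes c≡1) → let u , x~u , w~u = common x~w in case Heavy? w u of λ where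
                (yes h) → inArc {w} (1≤𝟙 (Arc? x w) (x~w , c≡1 , u , x~u , w~u , h))
                (no ¬hw) → case Heavy? x u of λ where
                  (yes h) → inT {w} (≤-trans (1≤heavyTriangle x~u h x~w (~-sym w~u)) (term≤∑ (heavyTriangle x w) u))
                  (no ¬hx) → ≤-trans
                    (1≤* (1≤𝟙 (x ~? w) x~w) (1≤𝟙 (joint? x w)
                      (u , (~-sym x~u , ¬hx ∘ Heavy-sym) , (~-sym w~u , ¬hw ∘ Heavy-sym))))
                    (m≤n+m (ℓ w) (𝟙 (Arc? x w) + (T w + R w)))
          pointwise : ∀ w → 𝟙 (x ~? w) ≤ 𝟙 (Arc? x w) + (T w + R w) + ℓ w
          pointwise w = 𝟙≤ (x ~? w) (cases w)

        arcs lights : ℕ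
        arcs = sum indeg
        lights = sum lightDeg

        arcs≡∑outdeg : arcs ≡ sum outdeg
        arcs≡∑outdeg = ∑-comm {n} {n} (λ w x → 𝟙 (Arc? x w))

        indeg≤n : ∀ w → indeg w ≤ n
        indeg≤n w = ≤-trans (∑≤n* 1 (λ x → 𝟙≤1 (Arc? x w))) (≤-reflexive (*-identityʳ n))

        ∑outdeg*indeg : ℕ
        ∑outdeg*indeg = ∑[ v < n ] (outdeg v * indeg v)

        ∑indeg² : ℕ
        ∑indeg² = ∑[ v < n ] (indeg v * indeg v)

        arcs²≤ : arcs * arcs ≤ n * ∑indeg²
        arcs²≤ = [∑f]²≤n∑f² indeg

        module _ (η : ℕ) (heavyDeg≤η : ∀ v → heavyDeg v ≤ η) where

          arc-bound : ∀ {x w} → Arc x w → 3 * σ + (indeg x + indeg w) ≤ n + 3 + 2 * η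
          arc-bound {x} {w} (x~w , c≡1 , u , x~u , w~u , _) = begin
            3 * σ + (indeg x + indeg w)
              ≤⟨ +-monoʳ-≤ (3 * σ) (+-mono-≤ (below x) (below w)) ⟩
            3 * σ + (excess x + η + (excess w + η))
              ≡⟨ rearrange (3 * σ) (excess x) (excess w) η ⟩
            3 * σ + (excess x + excess w) + 2 * η
              ≤⟨ +-monoˡ-≤ (2 * η) (triangle-bound x~w x~u w~u c≡1) ⟩
            n + 3 + 2 * η ∎
            where
            open ≤-Reasoning
            below : ∀ v → indeg v ≤ excess v + η
            below v = ≤-trans (indeg≤ v) (+-monoʳ-≤ (excess v) (heavyDeg≤η v))
            rearrange : ∀ s a b η → s + (a + η + (b + η)) ≡ s + (a + b) + 2 * η
            rearrange = solve-∀

          σ≤outdeg′ : ∀ x → σ ≤ outdeg x + 2 * η + lightDeg x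
          σ≤outdeg′ x = ≤-trans (σ≤outdeg x)
            (+-monoˡ-≤ (lightDeg x) (+-monoʳ-≤ (outdeg x) (*-monoʳ-≤ 2 (heavyDeg≤η x))))

          -- Sum `arc-bound` over all arcs: the indegree of a vertex occurs once for each arc
          -- leaving it and once for each arc entering it.
          arcs-bound : 3 * σ * arcs + ∑outdeg*indeg + ∑indeg² ≤ arcs * (n + 3 + 2 * η)
          arcs-bound = begin
            3 * σ * arcs + ∑outdeg*indeg + ∑indeg²
              ≡⟨ cong₂ _+_ (cong₂ _+_ s-part x-part) w-part ⟨
            ∑[ x < n ] ∑[ w < n ] (A x w * (3 * σ)) + ∑[ x < n ] ∑[ w < n ] (A x w * indeg x)
              + ∑[ x < n ] ∑[ w < n ] (A x w * indeg w)
              ≡⟨ trans (∑∑-distrib-+ {n} {n} (λ x w → A x w * (3 * σ) + A x w * indeg x) (λ x w → A x w * indeg w))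
                       (cong (_+ ∑[ x < n ] ∑[ w < n ] (A x w * indeg w))
                         (∑∑-distrib-+ {n} {n} (λ x w → A x w * (3 * σ)) (λ x w → A x w * indeg x))) ⟨
            ∑[ x < n ] ∑[ w < n ] (A x w * (3 * σ) + A x w * indeg x + A x w * indeg w)
              ≤⟨ ∑∑-mono {n} {n} pointwise ⟩
            ∑[ x < n ] ∑[ w < n ] (A x w * (n + 3 + 2 * η))
              ≡⟨ constant (n + 3 + 2 * η) ⟩
            (n + 3 + 2 * η) * arcs
              ≡⟨ *-comm (n + 3 + 2 * η) arcs ⟩
            arcs * (n + 3 + 2 * η) ∎
            where
            open ≤-Reasoning
            A : Fin n → Fin n → ℕ
            A x w = 𝟙 (Arc? x w)
            x-part : ∑[ x < n ] ∑[ w < n ] (A x w * indeg x) ≡ ∑outdeg*indeg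
            x-part = sum-cong-≗ (λ x → sym (*-distribʳ-sum (indeg x) (A x)))
            w-part : ∑[ x < n ] ∑[ w < n ] (A x w * indeg w) ≡ ∑indeg²
            w-part = trans (∑-comm {n} {n} (λ x w → A x w * indeg w))
              (sum-cong-≗ (λ w → sym (*-distribʳ-sum (indeg w) (λ x → A x w))))
            constant : ∀ c → ∑[ x < n ] ∑[ w < n ] (A x w * c) ≡ c * arcs
            constant c = trans (∑-comm {n} {n} (λ x w → A x w * c))
              (trans (∑∑-cong {n} {n} (λ w x → *-comm (A x w) c))
                     (sym (∑∑-distribˡ-* {n} {n} c (λ w x → A x w))))
            s-part : ∑[ x < n ] ∑[ w < n ] (A x w * (3 * σ)) ≡ 3 * σ * arcs
            s-part = constant (3 * σ)
            distrib : ∀ a s x w → a * s + a * x + a * w ≡ a * (s + (x + w))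
            distrib = solve-∀
            pointwise : ∀ x w → A x w * (3 * σ) + A x w * indeg x + A x w * indeg w ≤ A x w * (n + 3 + 2 * η)
            pointwise x w = ≤-trans (≤-reflexive (distrib (A x w) (3 * σ) (indeg x) (indeg w)))
              (𝟙-*-mono (Arc? x w) arc-bound)

          -- A lower bound for the mixed sum in `arcs-bound`: weight the outdegree bound at `v` by
          -- `indeg v`, using `indeg v` ≤ n in the light term.
          σ*arcs≤ : σ * arcs ≤ ∑outdeg*indeg + 2 * η * arcs + n * lights
          σ*arcs≤ = begin
            σ * arcs ≡⟨ *-distribˡ-sum σ indeg ⟩
            ∑[ v < n ] (σ * indeg v) ≤⟨ ∑-mono pointwise ⟩
            ∑[ v < n ] (outdeg v * indeg v + 2 * η * indeg v + n * lightDeg v)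
              ≡⟨ trans (∑-distrib-+ (λ v → outdeg v * indeg v + 2 * η * indeg v) (λ v → n * lightDeg v))
                   (cong₂ _+_ (trans (∑-distrib-+ (λ v → outdeg v * indeg v) (λ v → 2 * η * indeg v))
                                (cong (∑outdeg*indeg +_) (sym (*-distribˡ-sum (2 * η) indeg))))
                              (sym (*-distribˡ-sum n lightDeg))) ⟩
            ∑outdeg*indeg + 2 * η * arcs + n * lights ∎
            where
            open ≤-Reasoning
            expand : ∀ a b c d → (a + b + c) * d ≡ a * d + b * d + d * c
            expand = solve-∀
            pointwise : ∀ v → σ * indeg v ≤ outdeg v * indeg v + 2 * η * indeg v + n * lightDeg v
            pointwise v = begin
              σ * indeg v ≤⟨ *-monoˡ-≤ (indeg v) (σ≤outdeg′ v) ⟩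
              (outdeg v + 2 * η + lightDeg v) * indeg v
                ≡⟨ expand (outdeg v) (2 * η) (lightDeg v) (indeg v) ⟩
              outdeg v * indeg v + 2 * η * indeg v + indeg v * lightDeg v
                ≤⟨ +-monoʳ-≤ (outdeg v * indeg v + 2 * η * indeg v) (*-monoˡ-≤ (lightDeg v) (indeg≤n v)) ⟩
              outdeg v * indeg v + 2 * η * indeg v + n * lightDeg v ∎

          n*σ≤ : n * σ ≤ arcs + n * (2 * η) + lights
          n*σ≤ = begin
            n * σ ≡⟨ ∑-const n σ ⟨
            ∑[ v < n ] σ ≤⟨ ∑-mono σ≤outdeg′ ⟩
            ∑[ v < n ] (outdeg v + 2 * η + lightDeg v)
              ≡⟨ trans (∑-distrib-+ (λ v → outdeg v + 2 * η) lightDeg)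
                   (cong (_+ lights) (trans (∑-distrib-+ outdeg (λ _ → 2 * η))
                     (cong₂ _+_ (sym arcs≡∑outdeg) (∑-const n (2 * η))))) ⟩
            arcs + n * (2 * η) + lights ∎
            where open ≤-Reasoning

          arcs≤n² : arcs ≤ n * n
          arcs≤n² = ∑≤n* n indeg≤n

          -- Three of the five σ come from `arcs-bound` and one from `σ*arcs≤`. The fifth comes from
          -- `n*σ≤` multiplied by `arcs`, whose square is controlled by Cauchy-Schwarz. The mixed
          -- sum, the sum of squares and the square of `arcs` appear on both sides and cancel.
          five-σ-bound : 5 * σ * n * arcs ≤ n * arcs * (n + 3 + 6 * η) + 2 * (n * n * lights)
          five-σ-bound = +-cancelʳ-≤ (n * O + n * I + S * S) _ _ (begin
            5 * σ * n * S + (n * O + n * I + S * S)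
              ≡⟨ split n S O I σ ⟩
            n * (3 * σ * S + O + I) + n * (σ * S) + S * S + S * (n * σ)
              ≤⟨ +-mono-≤ (+-mono-≤ (+-mono-≤ (*-monoʳ-≤ n arcs-bound) (*-monoʳ-≤ n σ*arcs≤)) arcs²≤)
                          (*-monoʳ-≤ S n*σ≤) ⟩
            n * (S * (n + 3 + 2 * η)) + n * (O + 2 * η * S + n * lights) + n * I + S * (S + n * (2 * η) + lights)
              ≡⟨ collect n S O I η lights ⟩
            n * S * (n + 3 + 6 * η) + n * n * lights + S * lights + (n * O + n * I + S * S)
              ≤⟨ +-monoˡ-≤ (n * O + n * I + S * S)
                   (+-monoʳ-≤ (n * S * (n + 3 + 6 * η) + n * n * lights) (*-monoˡ-≤ lights arcs≤n²)) ⟩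
            n * S * (n + 3 + 6 * η) + n * n * lights + n * n * lights + (n * O + n * I + S * S)
              ≡⟨ cong (_+ (n * O + n * I + S * S)) (double (n * S * (n + 3 + 6 * η)) (n * n * lights)) ⟩
            n * S * (n + 3 + 6 * η) + 2 * (n * n * lights) + (n * O + n * I + S * S) ∎)
            where
            open ≤-Reasoning
            S = arcs
            O = ∑outdeg*indeg
            I = ∑indeg²
            split : ∀ n S O I σ → 5 * σ * n * S + (n * O + n * I + S * S) ≡
              n * (3 * σ * S + O + I) + n * (σ * S) + S * S + S * (n * σ)
            split = solve-∀
            collect : ∀ n S O I η L →
              n * (S * (n + 3 + 2 * η)) + n * (O + 2 * η * S + n * L) + n * I + S * (S + n * (2 * η) + L) ≡
              n * S * (n + 3 + 6 * η) + n * n * L + S * L + (n * O + n * I + S * S)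
            collect = solve-∀
            double : ∀ a b → a + b + b ≡ a + 2 * b
            double = solve-∀

        few-lights : ∀ Γ → Γ * edgeBudget K (Γ * (suc (2 * K * Γ) * suc (2 * K * Γ))) 1 0 ≤ n →
          Γ * lights ≤ 3 * (n * n)
        few-lights = jointEdges-few

      σ-bounded : ∀ q .{{_ : NonZero q}} → threshold q ≤ n → ¬ (n * q + 10 * n ≤ 5 * q * σ + 10 * q)
      σ-bounded q n-large σ-large = arithmetic-contradiction q n σ η (arcs K) (lights K)
        (≤-trans (≤-trans (m≤n+m (13 * q) 1) (m≤m+n (1 + 13 * q) _)) n-large)
        (≤-trans (≤-trans (m≤m+n 1 (13 * q)) (m≤m+n (1 + 13 * q) _)) n-large)
        σ-large
        (≤-trans (≤-reflexive (*-comm K η)) (m/n*n≤m (2 * n) K))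
        (five-σ-bound K η heavyDeg≤η) (n*σ≤ K η heavyDeg≤η)
        (few-lights K Γ (≤-trans (m≤n+m _ (1 + 13 * q)) n-large))
        where
        K = 12 * q
        Γ = 10 * (q * q) + 5 * q
        instance
          K≢0 : NonZero K
          K≢0 = m*n≢0 12 q
        -- Rounding down still bounds the integer `heavyDeg`, and gives 12qη ≤ 2n.
        η = 2 * n / K
        heavyDeg≤η : ∀ v → heavyDeg K v ≤ η
        heavyDeg≤η v = ≤-trans (≤-reflexive (sym (m*n/n≡m (heavyDeg K v) K)))
          (/-monoˡ-≤ K (≤-trans (≤-reflexive (*-comm (heavyDeg K v) K)) (K*heavyDeg≤2n K v)))

  -- The graph of an antichain

  ∣∣≡∑ : ∀ (Y : Subset n) → ∣ Y ∣ ≡ ∑[ x < n ] 𝟙 (x ∈? Y)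
  ∣∣≡∑ []            = refl
  ∣∣≡∑ (inside ∷ Y)  = cong suc (∣∣≡∑ Y)
  ∣∣≡∑ (outside ∷ Y) = ∣∣≡∑ Y

  -- Every point of `Y` occurs at some position of the list, and each position holds one point;
  -- repetitions are allowed.
  cover⇒∣∣≤ : ∀ {Y : Subset n} (xs : List (Fin n)) → (∀ {x} → x ∈ₛ Y → x ∈ xs) → ∣ Y ∣ ≤ length xs
  cover⇒∣∣≤ {n} {Y} xs cover = begin
    ∣ Y ∣                     ≡⟨ ∣∣≡∑ Y ⟩
    ∑[ x < n ] 𝟙 (x ∈? Y)     ≤⟨ ∑-mono (λ x → 𝟙≤ (x ∈? Y) (counted ∘ cover)) ⟩
    ∑[ x < n ] ∑[ l < length xs ] 𝟙 (lookup xs l Fin.≟ x)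
      ≡⟨ ∑-comm {n} {length xs} (λ x l → 𝟙 (lookup xs l Fin.≟ x)) ⟩
    ∑[ l < length xs ] ∑[ x < n ] 𝟙 (lookup xs l Fin.≟ x)
      ≡⟨ sum-cong-≗ (λ l → ∑-indicator (lookup xs l)) ⟩
    ∑[ l < length xs ] 1      ≡⟨ trans (∑-const (length xs) 1) (*-identityʳ (length xs)) ⟩
    length xs ∎
    where
    open ≤-Reasoning
    counted : ∀ {x} → x ∈ xs → 1 ≤ ∑[ l < length xs ] 𝟙 (lookup xs l Fin.≟ x)
    counted {x} x∈ = ≤-trans (1≤𝟙 (lookup xs (index x∈) Fin.≟ x) (sym (lookup-index x∈)))
                             (term≤∑ (λ l → 𝟙 (lookup xs l Fin.≟ x)) (index x∈))

  three-distinct⇒3≤∣∣ : ∀ {Y : Subset n} {i j k} → i ∈ₛ Y → j ∈ₛ Y → k ∈ₛ Y →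
    i ≢ j → i ≢ k → j ≢ k → 3 ≤ ∣ Y ∣
  three-distinct⇒3≤∣∣ {n} {Y} {i} {j} {k} i∈ j∈ k∈ i≢j i≢k j≢k = begin
    3 ≡⟨ cong₂ _+_ (∑-indicator i) (cong₂ _+_ (∑-indicator j) (∑-indicator k)) ⟨
    sum (δ i) + (sum (δ j) + sum (δ k))
      ≡⟨ trans (∑-distrib-+ (δ i) (λ x → δ j x + δ k x)) (cong (sum (δ i) +_) (∑-distrib-+ (δ j) (δ k))) ⟨
    ∑[ x < n ] (δ i x + (δ j x + δ k x)) ≤⟨ ∑-mono pointwise ⟩
    ∑[ x < n ] 𝟙 (x ∈? Y) ≡⟨ ∣∣≡∑ Y ⟨
    ∣ Y ∣ ∎
    where
    open ≤-Reasoning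
    δ : Fin n → Fin n → ℕ
    δ i x = 𝟙 (i Fin.≟ x)
    pointwise : ∀ x → δ i x + (δ j x + δ k x) ≤ 𝟙 (x ∈? Y)
    pointwise x with i Fin.≟ x | j Fin.≟ x | k Fin.≟ x
    ... | yes refl | yes refl | _        = contradiction refl i≢j
    ... | yes refl | no _     | yes refl = contradiction refl i≢k
    ... | yes refl | no _     | no _     = 1≤𝟙 (x ∈? Y) i∈
    ... | no _     | yes refl | yes refl = contradiction refl j≢k
    ... | no _     | yes refl | no _     = 1≤𝟙 (x ∈? Y) j∈
    ... | no _     | no _     | yes refl = 1≤𝟙 (x ∈? Y) k∈
    ... | no _     | no _     | no _     = z≤n

  ⟪_⟫ : List (Fin n) → Subset n
  ⟪ xs ⟫ = ⋃ (map ⁅_⁆ xs)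

  ∈⟪⟫⁺ : ∀ {x : Fin n} xs → x ∈ xs → x ∈ₛ ⟪ xs ⟫
  ∈⟪⟫⁺ (x ∷ _)  (here refl) = x∈p∪q⁺ (inj₁ (x∈⁅x⁆ x))
  ∈⟪⟫⁺ (_ ∷ xs) (there x∈)  = x∈p∪q⁺ (inj₂ (∈⟪⟫⁺ xs x∈))

  ∈⟪⟫⁻ : ∀ {x : Fin n} xs → x ∈ₛ ⟪ xs ⟫ → x ∈ xs
  ∈⟪⟫⁻ []       x∈ = contradiction x∈ ∉⊥
  ∈⟪⟫⁻ (y ∷ xs) x∈ = [ here ∘ x∈⁅y⁆⇒x≡y y , there ∘ ∈⟪⟫⁻ xs ]′ (x∈p∪q⁻ ⁅ y ⁆ ⟪ xs ⟫ x∈)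

  module Antichain {n : ℕ} {𝒜 : Family n} (M : IsMaximal23Antichain 𝒜) where
    open IsMaximal23Antichain M

    IsPair : Fin n → Fin n → Subset n → Set
    IsPair i j Y = i ∈ₛ Y × j ∈ₛ Y × ∣ Y ∣ ≡ 2

    pair? : ∀ i j → Dec (Any (IsPair i j) (members 𝒜))
    pair? i j = Any.any? (λ Y → i ∈? Y ×-dec j ∈? Y ×-dec ∣ Y ∣ ≟ 2) (members 𝒜)

    infix 4 _~_ _~?_

    _~_ : Fin n → Fin n → Set
    i ~ j = i ≢ j × ¬ Any (IsPair i j) (members 𝒜)

    _~?_ : Decidable _~_
    i ~? j = ¬? (i Fin.≟ j) ×-dec ¬? (pair? i j)

    ~-sym : Symmetric _~_
    ~-sym (i≢j , ¬pair) = i≢j ∘ sym , ¬pair ∘ Any.map (λ (p , q , c) → q , p , c)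

    comparable : ∀ Y → ∃[ A ] (A ∈ᶠ 𝒜 × (Y ⊆ A ⊎ A ⊆ Y))
    comparable Y with Any.any? (Vec.≡-dec Bool._≟_ Y) (members 𝒜)
    ... | yes Y∈ = Y , Y∈ , inj₁ ⊆-refl
    ... | no  Y∉ = maximal Y Y∉

    -- A triple does not fit into two points, and a 2-set inside {i, j} is {i, j} itself, which
    -- `i ~ j` forbids.
    member⊈pair : ∀ {A i j} → A ∈ᶠ 𝒜 → i ~ j → ¬ (∀ {x} → x ∈ₛ A → x ∈ i ∷ j ∷ [])
    member⊈pair {A} {i} {j} A∈ (_ , ¬pair) cover with sizes A∈
    ... | inj₂ ∣A∣≡3 = <⇒≱ (≤-reflexive (sym ∣A∣≡3)) (cover⇒∣∣≤ (i ∷ j ∷ []) cover)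
    ... | inj₁ ∣A∣≡2 with i ∈? A | j ∈? A
    ...   | yes i∈ | yes j∈ = ¬pair (lose A∈ (i∈ , j∈ , ∣A∣≡2))
    ...   | no i∉  | _      = <⇒≱ (≤-reflexive (sym ∣A∣≡2)) (cover⇒∣∣≤ (j ∷ []) λ x∈ →
      case cover x∈ of λ where
        (here refl) → contradiction x∈ i∉
        (there p)   → p)
    ...   | yes _  | no j∉  = <⇒≱ (≤-reflexive (sym ∣A∣≡2)) (cover⇒∣∣≤ (i ∷ []) λ x∈ →
      case cover x∈ of λ where
        (here p)            → here p
        (there (here refl)) → contradiction x∈ j∉)

    -- A member of size 2 containing `i` and `k` has no third point, so it would lie inside the
    -- triple `A`, against the antichain condition.
    edge-in-triple : ∀ {A i k} → A ∈ᶠ 𝒜 → ∣ A ∣ ≡ 3 → i ∈ₛ A → k ∈ₛ A → i ≢ k → i ~ k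
    edge-in-triple {A} {i} {k} A∈ ∣A∣≡3 i∈ k∈ i≢k = i≢k , λ pair →
      let B , B∈ , i∈B , k∈B , ∣B∣≡2 = find pair
          B⊆A : B ⊆ A
          B⊆A {x} x∈B = case ((i Fin.≟ x) , (k Fin.≟ x)) of λ where
            (yes refl , _)     → i∈
            (no _ , yes refl)  → k∈
            (no i≢x , no k≢x)  → contradiction (three-distinct⇒3≤∣∣ i∈B k∈B x∈B i≢k i≢x k≢x)
                                               (<⇒≱ (≤-reflexive (cong suc ∣B∣≡2)))
          B≢A : B ≢ A
          B≢A B≡A = case trans (sym ∣B∣≡2) (trans (cong ∣_∣ B≡A) ∣A∣≡3) of λ ()
      in antichain B∈ A∈ B≢A B⊆A

    -- The set {i, j} is comparable to a member, which by `member⊈pair` must contain it. That member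
    -- is not a pair, hence a triple, and its third point is the common neighbour.
    edge-in-triangle : ∀ {i j} → i ~ j → ∃[ k ] (i ~ k × j ~ k)
    edge-in-triangle {i} {j} i~j@(i≢j , ¬pair) with comparable ⟪ i ∷ j ∷ [] ⟫
    ... | A , A∈ , inj₂ A⊆ = ⊥-elim (member⊈pair A∈ i~j (∈⟪⟫⁻ (i ∷ j ∷ []) ∘ A⊆))
    ... | A , A∈ , inj₁ ⊆A = enlarge
      where
      i∈A : i ∈ₛ A
      i∈A = ⊆A (∈⟪⟫⁺ (i ∷ j ∷ []) (here refl))
      j∈A : j ∈ₛ A
      j∈A = ⊆A (∈⟪⟫⁺ (i ∷ j ∷ []) (there (here refl)))
      enlarge : ∃[ k ] (i ~ k × j ~ k)
      enlarge with sizes A∈ | Fin.any? (λ k → k ∈? A ×-dec ¬? (i Fin.≟ k) ×-dec ¬? (j Fin.≟ k))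
      ... | inj₁ ∣A∣≡2 | _ = contradiction (lose A∈ (i∈A , j∈A , ∣A∣≡2)) ¬pair
      ... | inj₂ ∣A∣≡3 | yes (k , k∈ , i≢k , j≢k) =
        k , edge-in-triple A∈ ∣A∣≡3 i∈A k∈ i≢k , edge-in-triple A∈ ∣A∣≡3 j∈A k∈ j≢k
      ... | inj₂ ∣A∣≡3 | no none = ⊥-elim (member⊈pair A∈ i~j cover)
        where
        cover : ∀ {x} → x ∈ₛ A → x ∈ i ∷ j ∷ []
        cover {x} x∈ with i Fin.≟ x | j Fin.≟ x
        ... | yes refl | _        = here refl
        ... | no _     | yes refl = there (here refl)
        ... | no i≢x   | no j≢x   = contradiction (x , x∈ , i≢x , j≢x) none

    -- A member inside {i, j, k} that missed a vertex would lie inside an edge, which `member⊈pair`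
    -- excludes.
    triangle-in-member : ∀ {i j k} → i ~ j → i ~ k → j ~ k →
      ∃[ A ] (A ∈ᶠ 𝒜 × i ∈ₛ A × j ∈ₛ A × k ∈ₛ A)
    triangle-in-member {i} {j} {k} i~j i~k j~k with comparable ⟪ i ∷ j ∷ k ∷ [] ⟫
    ... | A , A∈ , inj₁ ⊆A =
      A , A∈ , ⊆A (∈⟪⟫⁺ (i ∷ j ∷ k ∷ []) (here refl))
             , ⊆A (∈⟪⟫⁺ (i ∷ j ∷ k ∷ []) (there (here refl)))
             , ⊆A (∈⟪⟫⁺ (i ∷ j ∷ k ∷ []) (there (there (here refl))))
    ... | A , A∈ , inj₂ A⊆ with i ∈? A | j ∈? A | k ∈? A
    ...   | yes i∈ | yes j∈ | yes k∈ = A , A∈ , i∈ , j∈ , k∈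
    ...   | no i∉  | _      | _      = ⊥-elim (member⊈pair A∈ j~k drop)
      where
      drop : ∀ {x} → x ∈ₛ A → x ∈ j ∷ k ∷ []
      drop x∈ with ∈⟪⟫⁻ (i ∷ j ∷ k ∷ []) (A⊆ x∈)
      ... | here refl = contradiction x∈ i∉
      ... | there p   = p
    ...   | yes _  | no j∉  | _      = ⊥-elim (member⊈pair A∈ i~k drop)
      where
      drop : ∀ {x} → x ∈ₛ A → x ∈ i ∷ k ∷ []
      drop x∈ with ∈⟪⟫⁻ (i ∷ j ∷ k ∷ []) (A⊆ x∈)
      ... | here p             = here p
      ... | there (here refl)  = contradiction x∈ j∉
      ... | there (there p)    = there p
    ...   | yes _  | yes _  | no k∉  = ⊥-elim (member⊈pair A∈ i~j drop)
      where
      drop : ∀ {x} → x ∈ₛ A → x ∈ i ∷ j ∷ []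
      drop x∈ with ∈⟪⟫⁻ (i ∷ j ∷ k ∷ []) (A⊆ x∈)
      ... | here p                     = here p
      ... | there (here p)             = there (here p)
      ... | there (there (here refl))  = contradiction x∈ k∉

    ~⇒≢ : ∀ {i j} → i ~ j → i ≢ j
    ~⇒≢ = proj₁

    open Graph _~_ _~?_ ~-sym ~⇒≢

    codeg-positive : ∀ {i j} → i ~ j → 1 ≤ codeg i j
    codeg-positive {i} {j} i~j with edge-in-triangle i~j
    ... | k , i~k , j~k = ≤-trans (1≤* (1≤𝟙 (i ~? k) i~k) (1≤𝟙 (j ~? k) j~k))
                                  (term≤∑ (λ k → 𝟙 (i ~? k) * 𝟙 (j ~? k)) k)

    -- Members through a fixed vertex

    module _ (v : Fin n) where

      Other? : ∀ (Y : Subset n) j → Dec (j ∈ₛ Y × v ≢ j)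
      Other? Y j = j ∈? Y ×-dec ¬? (v Fin.≟ j)

      others : Subset n → ℕ
      others Y = ∑[ j < n ] 𝟙 (Other? Y j)

      otherPairs : Subset n → ℕ
      otherPairs Y = ∑[ j < n ] ∑[ k < n ] (𝟙 (Other? Y j) * (𝟙 (Other? Y k) * 𝟙 (¬? (j Fin.≟ k))))

      -- Equal to 2 for a member Y ∋ v of either size: a pair has one other point,
      -- a triple two ordered pairs of other points.
      weight : Subset n → ℕ
      weight Y = ∑[ j < n ] (2 * (𝟙 (Other? Y j) * 𝟙 (∣ Y ∣ ≟ 2))) + otherPairs Y

      remove-one : ∀ {P : Fin n → Set} (P? : ∀ j → Dec (P j)) i → P i →
        1 + ∑[ j < n ] (𝟙 (P? j) * 𝟙 (¬? (i Fin.≟ j))) ≤ ∑[ j < n ] 𝟙 (P? j)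
      remove-one P? i p = begin
        1 + ∑[ j < n ] (𝟙 (P? j) * 𝟙 (¬? (i Fin.≟ j)))
          ≡⟨ trans (∑-distrib-+ (λ j → 𝟙 (i Fin.≟ j)) (λ j → 𝟙 (P? j) * 𝟙 (¬? (i Fin.≟ j))))
                   (cong (_+ ∑[ j < n ] (𝟙 (P? j) * 𝟙 (¬? (i Fin.≟ j)))) (∑-indicator i)) ⟨
        ∑[ j < n ] (𝟙 (i Fin.≟ j) + 𝟙 (P? j) * 𝟙 (¬? (i Fin.≟ j))) ≤⟨ ∑-mono pointwise ⟩
        ∑[ j < n ] 𝟙 (P? j) ∎
        where
        open ≤-Reasoning
        pointwise : ∀ j → 𝟙 (i Fin.≟ j) + 𝟙 (P? j) * 𝟙 (¬? (i Fin.≟ j)) ≤ 𝟙 (P? j)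
        pointwise j with i Fin.≟ j
        ... | yes refl = ≤-trans (≤-reflexive (cong suc (*-zeroʳ (𝟙 (P? i))))) (1≤𝟙 (P? i) p)
        ... | no _     = ≤-reflexive (*-identityʳ (𝟙 (P? j)))

      others< : ∀ {Y} → v ∈ₛ Y → others Y < ∣ Y ∣
      others< {Y} v∈ = begin
        1 + others Y
          ≤⟨ +-monoʳ-≤ 1 (∑-mono (λ j → 𝟙≤ (Other? Y j) (λ (j∈ , v≢j) →
               1≤* (1≤𝟙 (j ∈? Y) j∈) (1≤𝟙 (¬? (v Fin.≟ j)) v≢j)))) ⟩
        1 + ∑[ j < n ] (𝟙 (j ∈? Y) * 𝟙 (¬? (v Fin.≟ j))) ≤⟨ remove-one (_∈? Y) v v∈ ⟩
        ∑[ j < n ] 𝟙 (j ∈? Y) ≡⟨ ∣∣≡∑ Y ⟨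
        ∣ Y ∣ ∎
        where open ≤-Reasoning

      otherPairs≤ : ∀ Y {m} → others Y ≤ suc m → otherPairs Y ≤ suc m * m
      otherPairs≤ Y {m} le = begin
        otherPairs Y
          ≤⟨ ∑-mono (λ j → ≤-trans
               (≤-reflexive (sym (*-distribˡ-sum (𝟙 (Other? Y j)) (λ k → 𝟙 (Other? Y k) * 𝟙 (¬? (j Fin.≟ k))))))
               (𝟙-*-mono (Other? Y j) (λ o → s≤s⁻¹ (≤-trans (remove-one (Other? Y) j o) le)))) ⟩
        ∑[ j < n ] (𝟙 (Other? Y j) * m) ≡⟨ *-distribʳ-sum m (λ j → 𝟙 (Other? Y j)) ⟨
        others Y * m ≤⟨ *-monoˡ-≤ m le ⟩
        suc m * m ∎
        where open ≤-Reasoning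

      weight≤2 : ∀ {Y} → Y ∈ᶠ 𝒜 → v ∈ₛ Y → weight Y ≤ 2
      weight≤2 {Y} Y∈ v∈ with sizes Y∈
      ... | inj₁ ∣Y∣≡2 = +-mono-≤ pairs (otherPairs≤ Y {0} others≤1)
        where
        open ≤-Reasoning
        others≤1 : others Y ≤ 1
        others≤1 = s≤s⁻¹ (≤-trans (others< v∈) (≤-reflexive ∣Y∣≡2))
        pairs : ∑[ j < n ] (2 * (𝟙 (Other? Y j) * 𝟙 (∣ Y ∣ ≟ 2))) ≤ 2
        pairs = begin
          ∑[ j < n ] (2 * (𝟙 (Other? Y j) * 𝟙 (∣ Y ∣ ≟ 2)))
            ≤⟨ ∑-mono (λ j → *-monoʳ-≤ 2 (≤-trans (*-monoʳ-≤ (𝟙 (Other? Y j)) (𝟙≤1 (∣ Y ∣ ≟ 2)))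
                                                  (≤-reflexive (*-identityʳ (𝟙 (Other? Y j)))))) ⟩
          ∑[ j < n ] (2 * 𝟙 (Other? Y j)) ≡⟨ *-distribˡ-sum 2 (λ j → 𝟙 (Other? Y j)) ⟨
          2 * others Y ≤⟨ *-monoʳ-≤ 2 others≤1 ⟩
          2 ∎
      ... | inj₂ ∣Y∣≡3 = +-mono-≤ pairs (otherPairs≤ Y {1} (s≤s⁻¹ (≤-trans (others< v∈) (≤-reflexive ∣Y∣≡3))))
        where
        pairs : ∑[ j < n ] (2 * (𝟙 (Other? Y j) * 𝟙 (∣ Y ∣ ≟ 2))) ≤ 0
        pairs = ≤-trans (∑≤n* 0 (λ j → *-monoʳ-≤ 2 {y = 0} (𝟙*≤ (Other? Y j) (λ _ →
                  𝟙≤ (∣ Y ∣ ≟ 2) (λ eq → case trans (sym eq) ∣Y∣≡3 of λ ())))))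
                (≤-reflexive (*-zeroʳ n))

      star : List (Subset n)
      star = filter (v ∈?_) (members 𝒜)

      -- The sum runs over positions in `star`, whose length is the degree of `v`.
      ∑★ : (Subset n → ℕ) → ℕ
      ∑★ f = ∑[ l < length star ] f (lookup star l)

      term≤∑★ : ∀ f {Y} → Y ∈ᶠ 𝒜 → v ∈ₛ Y → f Y ≤ ∑★ f
      term≤∑★ f {Y} Y∈ v∈ = ≤-trans (≤-reflexive (cong f (lookup-index Y∈★)))
                                     (term≤∑ (λ l → f (lookup star l)) (index Y∈★))
        where
        Y∈★ : Y ∈ star
        Y∈★ = ∈-filter⁺ (v ∈?_) Y∈ v∈

      ∑★weight≤ : ∑★ weight ≤ 2 * degree 𝒜 v
      ∑★weight≤ = ≤-trans
        (∑≤n* 2 (λ l → let Y∈ , v∈ = ∈-filter⁻ (v ∈?_) {xs = members 𝒜} (∈-lookup l) in weight≤2 Y∈ v∈))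
        (≤-reflexive (*-comm (length star) 2))

      pairsAt : Fin n → Subset n → ℕ
      pairsAt j Y = 𝟙 (Other? Y j) * 𝟙 (∣ Y ∣ ≟ 2)

      pair-count : ∀ j → 1 ≤ 𝟙 (v Fin.≟ j) + (𝟙 (v ~? j) + ∑★ (pairsAt j))
      pair-count j = case v Fin.≟ j of λ where
        (yes v≡j) → ≤-trans (1≤𝟙 (v Fin.≟ j) v≡j) (m≤m+n _ _)
        (no v≢j)  → ≤-trans (case pair? v j of λ where
          (no ¬pair) → ≤-trans (1≤𝟙 (v ~? j) (v≢j , ¬pair)) (m≤m+n _ _)
          (yes pair) → let Y , Y∈ , v∈ , j∈ , ∣Y∣≡2 = find pair in
            ≤-trans (≤-trans (1≤* (1≤𝟙 (Other? Y j) (j∈ , v≢j)) (1≤𝟙 (∣ Y ∣ ≟ 2) ∣Y∣≡2))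
                             (term≤∑★ (pairsAt j) Y∈ v∈))
                    (m≤n+m (∑★ (pairsAt j)) (𝟙 (v ~? j))))
          (m≤n+m _ (𝟙 (v Fin.≟ j)))

      otherPairAt : Fin n → Fin n → Subset n → ℕ
      otherPairAt j k Y = 𝟙 (Other? Y j) * (𝟙 (Other? Y k) * 𝟙 (¬? (j Fin.≟ k)))

      triangle-count : ∀ j k → 𝟙 (v ~? j) * (𝟙 (v ~? k) * 𝟙 (j ~? k)) ≤ ∑★ (otherPairAt j k)
      triangle-count j k = 𝟙*≤ (v ~? j) λ v~j → 𝟙*≤ (v ~? k) λ v~k → 𝟙≤ (j ~? k) λ j~k →
        let Y , Y∈ , v∈ , j∈ , k∈ = triangle-in-member v~j v~k j~k in
        ≤-trans (1≤* (1≤𝟙 (Other? Y j) (j∈ , proj₁ v~j))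
                     (1≤* (1≤𝟙 (Other? Y k) (k∈ , proj₁ v~k)) (1≤𝟙 (¬? (j Fin.≟ k)) (proj₁ j~k))))
                (term≤∑★ (otherPairAt j k) Y∈ v∈)

      ∑★-weight : ∑★ weight ≡ 2 * ∑[ j < n ] ∑★ (pairsAt j) + ∑[ j < n ] ∑[ k < n ] ∑★ (otherPairAt j k)
      ∑★-weight = trans
        (∑-distrib-+ (λ l → ∑[ j < n ] (2 * pairsAt j (lookup star l))) (λ l → otherPairs (lookup star l)))
        (cong₂ _+_
          (trans (∑-comm {length star} {n} (λ l j → 2 * pairsAt j (lookup star l)))
                 (sym (∑∑-distribˡ-* {n} {length star} 2 (λ j l → pairsAt j (lookup star l)))))
          (trans (∑-comm {length star} {n} (λ l j → ∑[ k < n ] otherPairAt j k (lookup star l)))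
                 (sum-cong-≗ (λ j → ∑-comm {length star} {n} (λ l k → otherPairAt j k (lookup star l))))))

      -- Each member through `v` has weight at most 2. The n - 1 - `deg v` points that are neither
      -- `v` nor its neighbours each lie with `v` in a 2-set, of weight 2. The ordered triangles at
      -- `v`, as many as the codegrees add up to, each lie in a member and count 1.
      degree-bound : 2 * n + ∑[ w < n ] (𝟙 (v ~? w) * codeg v w) ≤ 2 * (1 + deg v) + 2 * degree 𝒜 v
      degree-bound = begin
        2 * n + ∑[ w < n ] (𝟙 (v ~? w) * codeg v w)
          ≤⟨ +-mono-≤ (*-monoʳ-≤ 2 points) triangles ⟩
        2 * (1 + (deg v + ρ)) + τ
          ≡⟨ regroup (deg v) ρ τ ⟩
        2 * (1 + deg v) + (2 * ρ + τ)
          ≡⟨ cong (2 * (1 + deg v) +_) ∑★-weight ⟨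
        2 * (1 + deg v) + ∑★ weight
          ≤⟨ +-monoʳ-≤ (2 * (1 + deg v)) ∑★weight≤ ⟩
        2 * (1 + deg v) + 2 * degree 𝒜 v ∎
        where
        open ≤-Reasoning
        ρ τ : ℕ
        ρ = ∑[ j < n ] ∑★ (pairsAt j)
        τ = ∑[ j < n ] ∑[ k < n ] ∑★ (otherPairAt j k)
        regroup : ∀ d ρ τ → 2 * (1 + (d + ρ)) + τ ≡ 2 * (1 + d) + (2 * ρ + τ)
        regroup = solve-∀
        points : n ≤ 1 + (deg v + ρ)
        points = begin
          n ≡⟨ trans (∑-const n 1) (*-identityʳ n) ⟨
          ∑[ j < n ] 1 ≤⟨ ∑-mono pair-count ⟩
          ∑[ j < n ] (𝟙 (v Fin.≟ j) + (𝟙 (v ~? j) + ∑★ (pairsAt j)))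
            ≡⟨ trans (∑-distrib-+ (λ j → 𝟙 (v Fin.≟ j)) (λ j → 𝟙 (v ~? j) + ∑★ (pairsAt j)))
                 (cong₂ _+_ (∑-indicator v) (∑-distrib-+ (λ j → 𝟙 (v ~? j)) (λ j → ∑★ (pairsAt j)))) ⟩
          1 + (deg v + ρ) ∎
        triangles : ∑[ w < n ] (𝟙 (v ~? w) * codeg v w) ≤ τ
        triangles = ∑-mono (λ j → ≤-trans
          (≤-reflexive (*-distribˡ-sum (𝟙 (v ~? j)) (λ k → 𝟙 (v ~? k) * 𝟙 (j ~? k))))
          (∑-mono (triangle-count j)))

    -- This is r ≥ (9/10 - 1/q) n with denominators cleared. If it fails, then r < n, so n = 1 + r +
    -- s without truncated subtraction, and σ = 2s is at least n/5 + 2n/q - 2, which `σ-bounded`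
    -- rules out.
    regular-bound : ∀ q .{{_ : NonZero q}} {r} → threshold q ≤ n → IsRegular r 𝒜 →
      9 * n * q ≤ 10 * q * r + 10 * n
    regular-bound q {r} n-large regular = ≮⇒≥ λ r-small →
      let s , 1+r+s≡n = m≤n⇒∃[o]m+o≡n (r<n r-small) in
      σ-bounded (2 * s) codeg-positive (σ-bound s 1+r+s≡n) q n-large (σ-large s 1+r+s≡n (<⇒≤ r-small))
      where
      open ≤-Reasoning
      r<n : 10 * q * r + 10 * n < 9 * n * q → r < n
      r<n r-small = *-cancelˡ-< (10 * q) r n (begin-strict
        10 * q * r          ≤⟨ m≤m+n _ (10 * n) ⟩
        10 * q * r + 10 * n <⟨ r-small ⟩
        9 * n * q           ≤⟨ *-monoˡ-≤ q (*-monoˡ-≤ n (n≤1+n 9)) ⟩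
        10 * n * q          ≡⟨ swap n q ⟩
        10 * q * n ∎)
        where
        swap : ∀ n q → 10 * n * q ≡ 10 * q * n
        swap = solve-∀
      σ-bound : ∀ s → suc r + s ≡ n → ∀ v →
        2 * s + ∑[ w < n ] (𝟙 (v ~? w) * codeg v w) ≤ 2 * deg v
      σ-bound s 1+r+s≡n v = +-cancelˡ-≤ (2 * suc r) _ _ (begin
        2 * suc r + (2 * s + t)   ≡⟨ split r s t ⟩
        2 * (suc r + s) + t       ≡⟨ cong (λ m → 2 * m + t) 1+r+s≡n ⟩
        2 * n + t                 ≤⟨ degree-bound v ⟩
        2 * (1 + deg v) + 2 * degree 𝒜 v ≡⟨ cong (λ d → 2 * (1 + deg v) + 2 * d) (regular v) ⟩
        2 * (1 + deg v) + 2 * r   ≡⟨ merge (deg v) r ⟩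
        2 * suc r + 2 * deg v ∎)
        where
        t = ∑[ w < n ] (𝟙 (v ~? w) * codeg v w)
        split : ∀ r s t → 2 * suc r + (2 * s + t) ≡ 2 * (suc r + s) + t
        split = solve-∀
        merge : ∀ d r → 2 * (1 + d) + 2 * r ≡ 2 * suc r + 2 * d
        merge = solve-∀
      σ-large : ∀ s → suc r + s ≡ n → 10 * q * r + 10 * n ≤ 9 * n * q →
        n * q + 10 * n ≤ 5 * q * (2 * s) + 10 * q
      σ-large s 1+r+s≡n r-small = +-cancelˡ-≤ (10 * q * r) _ _ (begin
        10 * q * r + (n * q + 10 * n) ≡⟨ split (10 * q * r) (n * q) (10 * n) ⟩
        n * q + (10 * q * r + 10 * n) ≤⟨ +-monoʳ-≤ (n * q) r-small ⟩
        n * q + 9 * n * q             ≡⟨ collect n q ⟩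
        10 * q * n                    ≡⟨ cong (10 * q *_) 1+r+s≡n ⟨
        10 * q * (suc r + s)          ≡⟨ expand q r s ⟩
        10 * q * r + (5 * q * (2 * s) + 10 * q) ∎)
        where
        split : ∀ a b c → a + (b + c) ≡ b + (a + c)
        split = solve-∀
        collect : ∀ n q → n * q + 9 * n * q ≡ 10 * q * n
        collect = solve-∀
        expand : ∀ q r s → 10 * q * (suc r + s) ≡ 10 * q * r + (5 * q * (2 * s) + 10 * q)
        expand = solve-∀

-- Passage to rational ε

open Combinatorics using (threshold; module Antichain)

open import Defs
open import Data.Nat using (ℕ) renaming (_≤_ to _≤ₙ_)
open import Data.Integer using (+_)
open import Data.Rational using (ℚ; 0ℚ; _/_; _-_; _*_; _<_; _≥_)
open import Data.Product using (_×_; ∃-syntax)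

open import Data.Product using (_,_)
open import Data.Integer using (-[1+_])
import Data.Integer as ℤ
import Data.Integer.Properties as ℤ
open import Data.Integer.Tactic.RingSolver using () renaming (solve-∀ to solveℤ-∀)
import Data.Nat as ℕ
import Data.Nat.Properties as ℕ
open import Data.Rational using (mkℚ; toℚᵘ)
import Data.Rational as ℚ
import Data.Rational.Properties as ℚ
import Data.Rational.Unnormalised as ℚᵘ
import Data.Rational.Unnormalised.Properties as ℚᵘ
open import Relation.Binary.PropositionalEquality using (_≡_; refl; trans; cong; cong₂; subst₂)

-- The conclusion is the cross-multiplied form of (9/10 - (p + 1)/q) n ≤ r; the hypothesis is the
-- stronger bound with 1/q in place of (p + 1)/q.
clear-denominators : ∀ {p q n r : ℕ} → 9 ℕ.* n ℕ.* q ≤ₙ 10 ℕ.* q ℕ.* r ℕ.+ 10 ℕ.* n →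
  (+ 9 ℤ.* + q ℤ.+ ℤ.- (+ ℕ.suc p) ℤ.* + 10) ℤ.* + n ℤ.* + 1 ℤ.≤ + r ℤ.* (+ 10 ℤ.* + q ℤ.* + 1)
clear-denominators {p} {q} {n} {r} h = begin
  (+ 9 ℤ.* + q ℤ.+ ℤ.- (+ ℕ.suc p) ℤ.* + 10) ℤ.* + n ℤ.* + 1
    ≡⟨ expand (+ n) (+ q) (+ ℕ.suc p) ⟩
  + 9 ℤ.* + n ℤ.* + q ℤ.+ ℤ.- (+ 10 ℤ.* (+ ℕ.suc p ℤ.* + n))
    ≤⟨ ℤ.+-mono-≤ h′ (ℤ.neg-mono-≤ 10n≤) ⟩
  + 10 ℤ.* + q ℤ.* + r ℤ.+ + 10 ℤ.* + n ℤ.+ ℤ.- (+ 10 ℤ.* + n)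
    ≡⟨ cancel (+ n) (+ q) (+ r) ⟩
  + r ℤ.* (+ 10 ℤ.* + q ℤ.* + 1) ∎
  where
  open ℤ.≤-Reasoning
  expand : ∀ n q P → (+ 9 ℤ.* q ℤ.+ ℤ.- P ℤ.* + 10) ℤ.* n ℤ.* + 1 ≡
    + 9 ℤ.* n ℤ.* q ℤ.+ ℤ.- (+ 10 ℤ.* (P ℤ.* n))
  expand = solveℤ-∀
  cancel : ∀ n q r → + 10 ℤ.* q ℤ.* r ℤ.+ + 10 ℤ.* n ℤ.+ ℤ.- (+ 10 ℤ.* n) ≡ r ℤ.* (+ 10 ℤ.* q ℤ.* + 1)
  cancel = solveℤ-∀
  h′ : + 9 ℤ.* + n ℤ.* + q ℤ.≤ + 10 ℤ.* + q ℤ.* + r ℤ.+ + 10 ℤ.* + n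
  h′ = subst₂ ℤ._≤_
    (trans (ℤ.pos-* (9 ℕ.* n) q) (cong (ℤ._* + q) (ℤ.pos-* 9 n)))
    (trans (ℤ.pos-+ (10 ℕ.* q ℕ.* r) (10 ℕ.* n))
      (cong₂ ℤ._+_ (trans (ℤ.pos-* (10 ℕ.* q) r) (cong (ℤ._* + r) (ℤ.pos-* 10 q))) (ℤ.pos-* 10 n)))
    (ℤ.+≤+ h)
  10n≤ : + 10 ℤ.* + n ℤ.≤ + 10 ℤ.* (+ ℕ.suc p ℤ.* + n)
  10n≤ = ℤ.*-monoˡ-≤-nonNeg (+ 10) (subst₂ ℤ._≤_ refl (ℤ.pos-* (ℕ.suc p) n) (ℤ.+≤+ (ℕ.m≤m+n n (p ℕ.* n))))

corollary5 : ∀ (ε : ℚ) → 0ℚ < ε →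
    ∃[ n₀ ] (∀ (n : ℕ) → 3 ≤ₙ n → n₀ ≤ₙ n → ∀ (r : ℕ) →
    ∃[ 𝒜 ] (IsMaximal23Antichain {n} 𝒜 × IsRegular r 𝒜) →
    (+ r) / 1 ≥ ((+ 9) / 10 - ε) * ((+ n) / 1))
corollary5 (mkℚ (+ ℕ.zero)  _ _) (ℚ.*<* (ℤ.+<+ ()))
corollary5 (mkℚ -[1+ _ ]    _ _) (ℚ.*<* ())
-- As ε = (p + 1)/(d + 1) is at least 1/(d + 1), the choice q = d + 1 suffices.
corollary5 ε@(mkℚ (+ ℕ.suc p) d _) _ =
  threshold (ℕ.suc d) , λ n _ n-large r (𝒜 , maximal , regular) → ℚ.toℚᵘ-cancel-≤ (begin
    toℚᵘ (((+ 9) / 10 - ε) * ((+ n) / 1))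
      ≃⟨ ℚ.toℚᵘ-homo-* ((+ 9) / 10 - ε) ((+ n) / 1) ⟩
    toℚᵘ ((+ 9) / 10 - ε) ℚᵘ.* toℚᵘ ((+ n) / 1)
      ≃⟨ ℚᵘ.*-cong (ℚᵘ.≃-trans (ℚ.toℚᵘ-homo-+ ((+ 9) / 10) (ℚ.- ε))
                               (ℚᵘ.+-congʳ (toℚᵘ ((+ 9) / 10)) (ℚ.toℚᵘ-homo‿- ε)))
                   (ℚ.toℚᵘ-fromℚᵘ (ℚᵘ.mkℚᵘ (+ n) 0)) ⟩
    (ℚᵘ.mkℚᵘ (+ 9) 9 ℚᵘ.- toℚᵘ ε) ℚᵘ.* ℚᵘ.mkℚᵘ (+ n) 0
      ≤⟨ ℚᵘ.*≤* (clear-denominators {p} {ℕ.suc d} {n} {r}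
           (Antichain.regular-bound maximal (ℕ.suc d) n-large regular)) ⟩
    ℚᵘ.mkℚᵘ (+ r) 0
      ≃⟨ ℚ.toℚᵘ-fromℚᵘ (ℚᵘ.mkℚᵘ (+ r) 0) ⟨
    toℚᵘ ((+ r) / 1) ∎)
  where open ℚᵘ.≤-Reasoning
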